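{- Let $k$ be a positive integer and let $$b_k'=(-1)^{k(k+1)/2}\left(\frac{d}{dx}\right)^{2k}\left(e^{ -x/2}x^{ -k^2/2}\det_{k\times k}\big(I_{i+j-1}(2\sqrt{x})\big)_{1\le i,j\le k}\right)\bigg|_{x=0}.$$ Then $$b_k'=(-1)^{k(k+1)/2}\sum_{m\in P_O^{k+1}(2k)}\binom{2k}{m}\left(\frac{ -1}{2}\right)^{m_0}\left(\prod_{i=1}^k\frac{1}{(2k-i+m_i)!}\right)\left(\prod_{1\le i<j\le k}(m_j-m_i+i-j)\right).$$
   Context: $P_O^{k+1}(2k)$ is the set of $(k+1)$-tuples $m=(m_0,m_1,\dots,m_k)$ of non-negative integers with $m_0+\dots+m_k=2k$, and $\binom{2k}{m}=\frac{(2k)!}{m_0!\cdots m_k!}$ is the multinomial coefficient. $I_\nu$ is the modified Bessel function of the first kind, $I_n(x)=(x/2)^n\sum_{j\ge0}\frac{x^{2j}}{2^{2j}(n+j)!\,j!}$; the expression $x^{ -k^2/2}\det(I_{i+j-1}(2\sqrt x))$ is a power series in $x$. -}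

module Defs where

open import Data.Nat as ℕ using (ℕ; zero; suc; _!; _≡ᵇ_)
open import Data.Nat.Properties using (_!≢0)
open import Data.Nat.DivMod using (_%_)
import Data.Nat.DivMod as ℕD
open import Data.Integer as ℤ using (ℤ; +_)
open import Data.Rational using (ℚ; 0ℚ; 1ℚ; _+_; _*_; -_; _/_)
open import Data.Fin as Fin using (Fin; toℕ; punchIn)
open import Data.Vec as Vec using (Vec; []; _∷_)
open import Data.List as List using (List; []; _∷_; _++_; concatMap; upTo)
open import Data.Bool using (true; false; if_then_else_)

_^ℚ_ : ℚ → ℕ → ℚ
q ^ℚ zero  = 1ℚ
q ^ℚ suc n = q * (q ^ℚ n)

ℕ→ℚ : ℕ → ℚ
ℕ→ℚ n = + n / 1

ℤ→ℚ : ℤ → ℚ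
ℤ→ℚ z = z / 1

inv! : ℕ → ℚ
inv! n = (+ 1 / (n !)) {{n !≢0}}

sign : ℕ → ℚ
sign k = (- 1ℚ) ^ℚ (ℕD._/_ (k ℕ.* suc k) 2)

sumL : List ℚ → ℚ
sumL = List.foldr _+_ 0ℚ

prodL : List ℚ → ℚ
prodL = List.foldr _*_ 1ℚ

Σ< : ℕ → (ℕ → ℚ) → ℚ
Σ< zero    f = 0ℚ
Σ< (suc n) f = Σ< n f + f n

Series : Set
Series = ℕ → ℚ

0S : Series
0S _ = 0ℚ

1S : Series
1S zero    = 1ℚ
1S (suc _) = 0ℚ

_+S_ : Series → Series → Series
(f +S g) n = f n + g n

-S_ : Series → Series
(-S f) n = - f n

_*S_ : Series → Series → Series
(f *S g) n = Σ< (suc n) (λ i → f i * g (n ℕ.∸ i))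

detS : (n : ℕ) → (Fin n → Fin n → Series) → Series
detS zero    M = 1S
detS (suc n) M = go (suc n) (λ j → j)
  where
  term : Fin (suc n) → Series
  term j = ((- 1ℚ) ^ℚ toℕ j) ⊙ (M Fin.zero j *S detS n (λ a b → M (Fin.suc a) (punchIn j b)))
    where
    _⊙_ : ℚ → Series → Series
    (c ⊙ f) t = c * f t
  go : (m : ℕ) → (Fin m → Fin (suc n)) → Series
  go zero    ι = 0S
  go (suc m) ι = term (ι Fin.zero) +S go m (λ a → ι (Fin.suc a))

-- Series in the variable y = √x

-- I_n(z) = (z/2)^n Σ_j z^{2j} / (2^{2j} (n+j)! j!), as a series in z:
-- the coefficient of z^t is 1/(2^t (n+j)! j!) if t = n + 2j, and 0 otherwise.
besselI : ℕ → Series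
besselI n t with t ℕ.<ᵇ n
... | true  = 0ℚ
... | false = if ((t ℕ.∸ n) % 2) ≡ᵇ 0
                then ((+ 1 / 2) ^ℚ t) * inv! (n ℕ.+ j) * inv! j
                else 0ℚ
  where
  j = ℕD._/_ (t ℕ.∸ n) 2

-- substitution z ↦ 2y : coefficient of y^t gets multiplied by 2^t
at2y : Series → Series
at2y f t = ℕ→ℚ (2 ℕ.^ t) * f t

-- e^{-x/2} = Σ_j (-1/2)^j x^j / j!, as a series in y (x = y²)
expNegHalfX : Series
expNegHalfX t = if (t % 2) ≡ᵇ 0
                  then ((- (+ 1 / 2)) ^ℚ (ℕD._/_ t 2)) * inv! (ℕD._/_ t 2)
                  else 0ℚ

-- multiplication by y^{-s}, i.e. by x^{-s/2}
shiftDown : ℕ → Series → Series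
shiftDown s f t = f (t ℕ.+ s)

-- reading a series in y (with only even powers) as a series in x = y²
asSeriesInX : Series → Series
asSeriesInX f n = f (2 ℕ.* n)

-- (d/dx)^n F |_{x=0} = n! · [x^n] F
derivAt0 : ℕ → Series → ℚ
derivAt0 n F = ℕ→ℚ (n !) * F n

-- det_{k×k}( I_{i+j-1}(2√x) )_{1≤i,j≤k}, as a series in y = √x
-- (0-based indices: entry (i,j) is I_{i+j+1})
besselDet : (k : ℕ) → Series
besselDet k = detS k (λ i j → at2y (besselI (suc (toℕ i ℕ.+ toℕ j))))

bk' : ℕ → ℚ
bk' k = sign k * derivAt0 (2 ℕ.* k)
          (asSeriesInX (expNegHalfX *S shiftDown (k ℕ.* k) (besselDet k)))

compositions : (p s : ℕ) → List (Vec ℕ p)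
compositions zero    zero    = [] ∷ []
compositions zero    (suc s) = []
compositions (suc p) s =
  concatMap (λ a → List.map (a ∷_) (compositions p (s ℕ.∸ a))) (upTo (suc s))

-- multinomial coefficient (2k choose m) = (Σ m)! / Π m_i!, here with Σ m = N
multinomial : ∀ {p} → ℕ → Vec ℕ p → ℚ
multinomial N m = ℕ→ℚ (N !) * prodL (Vec.toList (Vec.map inv! m))

summand : (k : ℕ) → Vec ℕ (suc k) → ℚ
summand k m =
  multinomial (2 ℕ.* k) m
  * ((- (+ 1 / 2)) ^ℚ Vec.head m)
  * prodL (List.map (λ i → inv! ((2 ℕ.* k ℕ.∸ i) ℕ.+ mi i)) (List.map suc (upTo k)))
  * prodL (concatMap (λ j → List.map (λ i →
        ℤ→ℚ (((+ mi j) ℤ.- (+ mi i)) ℤ.+ ((+ i) ℤ.- (+ j))))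
        (List.map suc (upTo (j ℕ.∸ 1))))
      (List.map suc (upTo k)))
  where
  -- m_i for 1 ≤ i ≤ k (0 outside range, never used)
  mi : ℕ → ℕ
  mi i = go i m
    where
    go : ∀ {p} → ℕ → Vec ℕ p → ℕ
    go _       []      = 0
    go zero    (x ∷ _) = x
    go (suc i) (_ ∷ v) = go i v

rhs : ℕ → ℚ
rhs k = sign k * sumL (List.map (summand k) (compositions (suc k) (2 ℕ.* k)))

{-# OPTIONS --safe #-}
-- Write I_n(2y) = y^n Σ_l x^l / ((n+l)! l!) with x = y².  The entry (i,j) of the determinant then
-- carries the factor y^(i+j-1), which splits over rows and columns; together these factors give
-- y^(k²).  Expanding the remaining determinant of series in x by multilinearity in the rows, its
-- x^s coefficient is a sum over the compositions (l_1,…,l_k) of s of Π 1/l_i! · det(1/(b_i+j)!)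
-- with b_i = i + l_i and 0 ≤ j < k.  Since 1/(b+j)! = (b+j+1)/(b+j+1)!, subtracting b₁+j+1 times
-- column j+1 from column j leaves (b - b₁)/(b+j+1)!, as in the evaluation of a Vandermonde
-- determinant, so that det(1/(b_i+j)!) = Π_i 1/(b_i+k-1)! · Π_{i<j} (b_i - b_j).  Put m_i = l_{k+1-i}.
module Submission where

open import Defs
open import Data.Nat using (ℕ; suc)
open import Relation.Binary.PropositionalEquality using (_≡_)

open import Algebra.Bundles using (CommutativeRing)
open import Data.Bool using (true; false; T; if_then_else_)
open import Data.Fin as Fin using (Fin; toℕ; punchIn)
open import Data.Integer as ℤ using (ℤ)
import Data.Integer.Properties as ℤ
open import Data.List as List using (List; []; _∷_; _++_; length; concatMap; upTo; applyUpTo; applyDownFrom; tabulate)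
open import Data.List.Properties using (++-assoc; map-++; map-∘; map-cong; map-upTo; map-applyUpTo; length-applyDownFrom; tabulate-cong)
open import Data.List.Relation.Binary.Pointwise as Pointwise using (Pointwise; []; _∷_)
open import Data.Nat as ℕ using (zero; _!; _<_; z≤n; s≤s)
import Data.Nat.DivMod as ℕ
import Data.Nat.Properties as ℕ
open import Data.Nat.Tactic.RingSolver using (solve-∀)
open import Data.Rational using (ℚ; 0ℚ; 1ℚ; _+_; _*_; -_; _-_; _/_; toℚᵘ)
open import Data.Rational.Properties
open import Data.Rational.Solver using (module +-*-Solver)
import Data.Rational.Unnormalised as ℚᵘ
import Data.Rational.Unnormalised.Properties as ℚᵘ
open import Data.Vec as Vec using (Vec; []; _∷_; _∷ʳ_)
open import Function using (_∘_)
open import Relation.Binary.PropositionalEquality using (refl; sym; trans; cong; cong₂; subst; module ≡-Reasoning)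
import Algebra.Properties.CommutativeMonoid.Sum ℕ.+-0-commutativeMonoid as ℕΣ
open import Algebra.Properties.Semiring.Sum (CommutativeRing.semiring +-*-commutativeRing) using (sum; sum-cong-≗; ∑-distrib-+; *-distribˡ-sum; sum-replicate-zero)
open ≡-Reasoning
open +-*-Solver

-- Rational arithmetic

-- `detS` is given only by expansion along the first row, so the column operations are carried out
-- on a second, numerical determinant `det`. Once the degrees l_i are chosen, row i depends on its
-- label b_i = i + l_i alone; a column is then a function of the label, and a column operation is
-- one identity in b, valid in all rows at once. The multiplier b₁ + j + 1 is chosen to clear the
-- first row up to its last entry, and the sign of that entry turns each b - b₁ into b₁ - b. The
-- reversal m_i = l_(k+1-i) is a matter of orientation: the Vandermonde factors are upper label
-- minus lower label, whereas the formula has m_j - m_i + i - j for i < j, and after the reversal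
-- the two agree without a sign. The remaining index m_0 is the degree taken from e^(-x/2); its
-- 1/m_0! and the (2k)! of the derivative complete the multinomial coefficient.

private
  -- `z / 1` is normalised by a gcd, which is stuck on a variable z. Among unnormalised rationals
  -- the homomorphism laws become equations of integers.
  toℚᵘ-ℤ→ℚ : ∀ z → toℚᵘ (ℤ→ℚ z) ℚᵘ.≃ ℚᵘ.mkℚᵘ z 0
  toℚᵘ-ℤ→ℚ z = toℚᵘ-fromℚᵘ (ℚᵘ.mkℚᵘ z 0)

ℤ→ℚ-+ : ∀ x y → ℤ→ℚ (x ℤ.+ y) ≡ ℤ→ℚ x + ℤ→ℚ y
ℤ→ℚ-+ x y = toℚᵘ-injective
  (ℚᵘ.≃-trans (toℚᵘ-ℤ→ℚ (x ℤ.+ y))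
  (ℚᵘ.≃-trans (ℚᵘ.*≡* (cong (ℤ._* ℤ.+ 1) (cong₂ ℤ._+_ (sym (ℤ.*-identityʳ x)) (sym (ℤ.*-identityʳ y)))))
  (ℚᵘ.≃-trans (ℚᵘ.+-cong (ℚᵘ.≃-sym (toℚᵘ-ℤ→ℚ x)) (ℚᵘ.≃-sym (toℚᵘ-ℤ→ℚ y)))
  (ℚᵘ.≃-sym (toℚᵘ-homo-+ (ℤ→ℚ x) (ℤ→ℚ y))))))

ℤ→ℚ-* : ∀ x y → ℤ→ℚ (x ℤ.* y) ≡ ℤ→ℚ x * ℤ→ℚ y
ℤ→ℚ-* x y = toℚᵘ-injective
  (ℚᵘ.≃-trans (toℚᵘ-ℤ→ℚ (x ℤ.* y))
  (ℚᵘ.≃-trans (ℚᵘ.*-cong (ℚᵘ.≃-sym (toℚᵘ-ℤ→ℚ x)) (ℚᵘ.≃-sym (toℚᵘ-ℤ→ℚ y)))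
  (ℚᵘ.≃-sym (toℚᵘ-homo-* (ℤ→ℚ x) (ℤ→ℚ y)))))

ℤ→ℚ-neg : ∀ x → ℤ→ℚ (ℤ.- x) ≡ - ℤ→ℚ x
ℤ→ℚ-neg x = toℚᵘ-injective
  (ℚᵘ.≃-trans (toℚᵘ-ℤ→ℚ (ℤ.- x))
  (ℚᵘ.≃-trans (ℚᵘ.-‿cong (ℚᵘ.≃-sym (toℚᵘ-ℤ→ℚ x)))
  (ℚᵘ.≃-sym (toℚᵘ-homo‿- (ℤ→ℚ x)))))

ℕ→ℚ-+ : ∀ m n → ℕ→ℚ (m ℕ.+ n) ≡ ℕ→ℚ m + ℕ→ℚ n
ℕ→ℚ-+ m n = ℤ→ℚ-+ (ℤ.+ m) (ℤ.+ n)

ℕ→ℚ-* : ∀ m n → ℕ→ℚ (m ℕ.* n) ≡ ℕ→ℚ m * ℕ→ℚ n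
ℕ→ℚ-* m n = trans (cong ℤ→ℚ (ℤ.pos-* m n)) (ℤ→ℚ-* (ℤ.+ m) (ℤ.+ n))

*-inverse-/ : ∀ n .{{_ : ℕ.NonZero n}} → ℕ→ℚ n * (ℤ.+ 1 / n) ≡ 1ℚ
*-inverse-/ (suc n) = toℚᵘ-injective
  (ℚᵘ.≃-trans (toℚᵘ-homo-* (ℕ→ℚ (suc n)) (ℤ.+ 1 / suc n))
  (ℚᵘ.≃-trans (ℚᵘ.*-cong (toℚᵘ-ℤ→ℚ (ℤ.+ suc n)) (toℚᵘ-fromℚᵘ (ℚᵘ.mkℚᵘ (ℤ.+ 1) n)))
  (ℚᵘ.*≡* (begin
    ℤ.+ suc n ℤ.* ℤ.+ 1 ℤ.* ℤ.+ 1      ≡⟨ ℤ.*-identityʳ (ℤ.+ suc n ℤ.* ℤ.+ 1) ⟩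
    ℤ.+ suc n ℤ.* ℤ.+ 1                ≡⟨ ℤ.*-identityʳ (ℤ.+ suc n) ⟩
    ℤ.+ suc n                          ≡⟨ cong ℤ.+_ (trans (ℕ.+-identityʳ (suc (n ℕ.+ 0))) (ℕ.+-identityʳ (suc n))) ⟨
    ℤ.+ suc (n ℕ.+ 0 ℕ.+ 0)            ∎))))

inv!-inverse : ∀ n → ℕ→ℚ (n !) * inv! n ≡ 1ℚ
inv!-inverse n = *-inverse-/ (n !) {{n ℕ.!≢0}}

inv!-suc : ∀ n → inv! n ≡ ℕ→ℚ (suc n) * inv! (suc n)
inv!-suc n = begin
  inv! n                                                      ≡⟨ *-identityʳ _ ⟨
  inv! n * 1ℚ                                                 ≡⟨ cong (inv! n *_) (inv!-inverse (suc n)) ⟨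
  inv! n * (ℕ→ℚ (suc n !) * inv! (suc n))                     ≡⟨ cong (λ q → inv! n * (q * inv! (suc n))) (ℕ→ℚ-* (suc n) (n !)) ⟩
  inv! n * (ℕ→ℚ (suc n) * ℕ→ℚ (n !) * inv! (suc n))           ≡⟨ solve 4 (λ a b c d → a :* (b :* c :* d) := c :* a :* (b :* d)) refl (inv! n) (ℕ→ℚ (suc n)) (ℕ→ℚ (n !)) (inv! (suc n)) ⟩
  ℕ→ℚ (n !) * inv! n * (ℕ→ℚ (suc n) * inv! (suc n))           ≡⟨ cong (_* (ℕ→ℚ (suc n) * inv! (suc n))) (inv!-inverse n) ⟩
  1ℚ * (ℕ→ℚ (suc n) * inv! (suc n))                           ≡⟨ *-identityˡ _ ⟩
  ℕ→ℚ (suc n) * inv! (suc n)                                  ∎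

2^-inverse : ∀ t → ℕ→ℚ (2 ℕ.^ t) * ((ℤ.+ 1 / 2) ^ℚ t) ≡ 1ℚ
2^-inverse zero    = refl
2^-inverse (suc t) = begin
  ℕ→ℚ (2 ℕ.^ suc t) * (½ * h)        ≡⟨ cong (_* (½ * h)) (ℕ→ℚ-* 2 (2 ℕ.^ t)) ⟩
  ℕ→ℚ 2 * ℕ→ℚ (2 ℕ.^ t) * (½ * h)    ≡⟨ solve 4 (λ a b c d → a :* b :* (c :* d) := a :* c :* (b :* d)) refl (ℕ→ℚ 2) (ℕ→ℚ (2 ℕ.^ t)) ½ h ⟩
  ℕ→ℚ 2 * ½ * (ℕ→ℚ (2 ℕ.^ t) * h)    ≡⟨ cong (ℕ→ℚ 2 * ½ *_) (2^-inverse t) ⟩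
  1ℚ                                 ∎
  where
  ½ = ℤ.+ 1 / 2
  h = ½ ^ℚ t

-- Sums over initial segments

Σ<-cong : ∀ n {f g} → (∀ i → i < n → f i ≡ g i) → Σ< n f ≡ Σ< n g
Σ<-cong zero    f≗g = refl
Σ<-cong (suc n) f≗g = cong₂ _+_ (Σ<-cong n (λ i i<n → f≗g i (ℕ.m<n⇒m<1+n i<n))) (f≗g n ℕ.≤-refl)

Σ<-cong′ : ∀ n {f g} → (∀ i → f i ≡ g i) → Σ< n f ≡ Σ< n g
Σ<-cong′ n f≗g = Σ<-cong n (λ i _ → f≗g i)

Σ<-zero : ∀ n → Σ< n (λ _ → 0ℚ) ≡ 0ℚ
Σ<-zero zero    = refl
Σ<-zero (suc n) = cong (_+ 0ℚ) (Σ<-zero n)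

Σ<-+ : ∀ n f g → Σ< n (λ i → f i + g i) ≡ Σ< n f + Σ< n g
Σ<-+ zero    f g = refl
Σ<-+ (suc n) f g = trans (cong (_+ (f n + g n)) (Σ<-+ n f g))
  (solve 4 (λ a b c d → a :+ b :+ (c :+ d) := a :+ c :+ (b :+ d)) refl (Σ< n f) (Σ< n g) (f n) (g n))

Σ<-*ˡ : ∀ n c f → c * Σ< n f ≡ Σ< n (λ i → c * f i)
Σ<-*ˡ zero    c f = *-zeroʳ c
Σ<-*ˡ (suc n) c f = trans (*-distribˡ-+ c (Σ< n f) (f n)) (cong (_+ c * f n) (Σ<-*ˡ n c f))

Σ<-head : ∀ n f → Σ< (suc n) f ≡ f 0 + Σ< n (f ∘ suc)
Σ<-head zero    f = +-comm 0ℚ (f 0)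
Σ<-head (suc n) f = trans (cong (_+ f (suc n)) (Σ<-head n f)) (+-assoc (f 0) _ _)

Σ<-sum : ∀ n {m} (f : Fin m → ℕ → ℚ) → sum (λ j → Σ< n (f j)) ≡ Σ< n (λ i → sum (λ j → f j i))
Σ<-sum n {zero}  f = sym (Σ<-zero n)
Σ<-sum n {suc m} f = trans (cong (Σ< n (f Fin.zero) +_) (Σ<-sum n (f ∘ Fin.suc)))
  (sym (Σ<-+ n (f Fin.zero) (λ i → sum (λ j → f (Fin.suc j) i))))

-- Both sides run over the pairs with a + b < n. The induction removes the row a = 0; the empty sum
-- `last` gives the remaining sum over b the same length as that row.
Σ<-triangle : ∀ n (f : ℕ → ℕ → ℚ) →
  Σ< n (λ a → Σ< (n ℕ.∸ a) (f a)) ≡ Σ< n (λ b → Σ< (n ℕ.∸ b) (λ a → f a b))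
Σ<-triangle zero    f = refl
Σ<-triangle (suc n) f = begin
  Σ< (suc n) (λ a → Σ< (suc n ℕ.∸ a) (f a))
    ≡⟨ Σ<-head n _ ⟩
  Σ< (suc n) (f 0) + Σ< n (λ a → Σ< (n ℕ.∸ a) (f (suc a)))
    ≡⟨ cong (Σ< (suc n) (f 0) +_) (Σ<-triangle n (f ∘ suc)) ⟩
  Σ< (suc n) (f 0) + Σ< n inner
    ≡⟨ cong (Σ< (suc n) (f 0) +_) (trans (sym (+-identityʳ _)) (cong (Σ< n inner +_) (sym last))) ⟩
  Σ< (suc n) (f 0) + Σ< (suc n) inner
    ≡⟨ Σ<-+ (suc n) (f 0) inner ⟨
  Σ< (suc n) (λ b → f 0 b + inner b)
    ≡⟨ Σ<-cong (suc n) (λ b b<1+n → trans (sym (Σ<-head (n ℕ.∸ b) (λ a → f a b)))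
         (cong (λ k → Σ< k (λ a → f a b)) (sym (ℕ.+-∸-assoc 1 (ℕ.s≤s⁻¹ b<1+n))))) ⟩
  Σ< (suc n) (λ b → Σ< (suc n ℕ.∸ b) (λ a → f a b))
    ∎
  where
  inner : ℕ → ℚ
  inner b = Σ< (n ℕ.∸ b) (λ a → f (suc a) b)
  last : inner n ≡ 0ℚ
  last = cong (λ k → Σ< k (λ a → f (suc a) n)) (ℕ.n∸n≡0 n)

-- Series in y = √x: multiplication by powers of y, and substitution x = y²

*S-cong : ∀ {f f′ g g′} → (∀ t → f t ≡ f′ t) → (∀ t → g t ≡ g′ t) → ∀ t → (f *S g) t ≡ (f′ *S g′) t
*S-cong f≗ g≗ t = Σ<-cong′ (suc t) (λ i → cong₂ _*_ (f≗ i) (g≗ (t ℕ.∸ i)))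

*S-suc : ∀ f g t → (f *S g) (suc t) ≡ f 0 * g (suc t) + ((f ∘ suc) *S g) t
*S-suc f g t = Σ<-head (suc t) _

-- Multiplication by y^w. Recursion on exponent and index together avoids truncated subtraction.
shiftUp : ℕ → Series → Series
shiftUp zero    f t       = f t
shiftUp (suc w) f zero    = 0ℚ
shiftUp (suc w) f (suc t) = shiftUp w f t

-- The series h(y²). Two indices of y pass for one of x, so proofs need no parity test; `dilate-if`
-- recovers the test by which the given series are defined.
dilate : Series → Series
dilate h zero          = h 0
dilate h (suc zero)    = 0ℚ
dilate h (suc (suc t)) = dilate (h ∘ suc) t

shiftUp-cong : ∀ w {f g} → (∀ t → f t ≡ g t) → ∀ t → shiftUp w f t ≡ shiftUp w g t
shiftUp-cong zero    f≗g t       = f≗g t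
shiftUp-cong (suc w) f≗g zero    = refl
shiftUp-cong (suc w) f≗g (suc t) = shiftUp-cong w f≗g t

shiftUp-+ : ∀ w f t → shiftUp w f (w ℕ.+ t) ≡ f t
shiftUp-+ zero    f t = refl
shiftUp-+ (suc w) f t = shiftUp-+ w f t

shiftUp-< : ∀ {w t} f → t < w → shiftUp w f t ≡ 0ℚ
shiftUp-< {t = zero}  f (s≤s _)   = refl
shiftUp-< {t = suc t} f (s≤s t<w) = shiftUp-< f t<w

shiftUp-shiftUp : ∀ w v f t → shiftUp w (shiftUp v f) t ≡ shiftUp (w ℕ.+ v) f t
shiftUp-shiftUp zero    v f t       = refl
shiftUp-shiftUp (suc w) v f zero    = refl
shiftUp-shiftUp (suc w) v f (suc t) = shiftUp-shiftUp w v f t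

shiftUp-*ˡ : ∀ w f g t → (shiftUp w f *S g) t ≡ shiftUp w (f *S g) t
shiftUp-*ˡ zero    f g t       = refl
shiftUp-*ˡ (suc w) f g zero    = cong (λ q → 0ℚ + q) (*-zeroˡ (g 0))
shiftUp-*ˡ (suc w) f g (suc t) = begin
  (shiftUp (suc w) f *S g) (suc t)             ≡⟨ *S-suc (shiftUp (suc w) f) g t ⟩
  0ℚ * g (suc t) + (shiftUp w f *S g) t        ≡⟨ cong₂ _+_ (*-zeroˡ (g (suc t))) (shiftUp-*ˡ w f g t) ⟩
  0ℚ + shiftUp w (f *S g) t                    ≡⟨ +-identityˡ _ ⟩
  shiftUp w (f *S g) t                         ∎

shiftUp-*ʳ : ∀ w f g t → (f *S shiftUp w g) t ≡ shiftUp w (f *S g) t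
shiftUp-*ʳ zero    f g t       = refl
shiftUp-*ʳ (suc w) f g zero    = cong (λ q → 0ℚ + q) (*-zeroʳ (f 0))
shiftUp-*ʳ (suc w) f g (suc t) = begin
  (f *S shiftUp (suc w) g) (suc t)
    -- The last term meets the constant coefficient of a shifted series, which is 0; in every other
    -- term `suc t ∸ i` is a successor.
    ≡⟨ cong₂ _+_
         (Σ<-cong (suc t) (λ i i<1+t → cong (λ k → f i * shiftUp (suc w) g k) (ℕ.+-∸-assoc 1 (ℕ.s≤s⁻¹ i<1+t))))
         (trans (cong (λ k → f (suc t) * shiftUp (suc w) g k) (ℕ.n∸n≡0 t)) (*-zeroʳ (f (suc t)))) ⟩
  (f *S shiftUp w g) t + 0ℚ    ≡⟨ +-identityʳ _ ⟩
  (f *S shiftUp w g) t         ≡⟨ shiftUp-*ʳ w f g t ⟩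
  shiftUp w (f *S g) t         ∎

shiftUp-* : ∀ w v f g t → (shiftUp w f *S shiftUp v g) t ≡ shiftUp (w ℕ.+ v) (f *S g) t
shiftUp-* w v f g t = begin
  (shiftUp w f *S shiftUp v g) t    ≡⟨ shiftUp-*ˡ w f (shiftUp v g) t ⟩
  shiftUp w (f *S shiftUp v g) t    ≡⟨ shiftUp-cong w (shiftUp-*ʳ v f g) t ⟩
  shiftUp w (shiftUp v (f *S g)) t  ≡⟨ shiftUp-shiftUp w v _ t ⟩
  shiftUp (w ℕ.+ v) (f *S g) t      ∎

shiftUp-sum : ∀ w {m} (c : Fin m → ℚ) (f : Fin m → Series) t →
  sum (λ j → c j * shiftUp w (f j) t) ≡ shiftUp w (λ s → sum (λ j → c j * f j s)) t
shiftUp-sum zero    c f t       = refl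
shiftUp-sum (suc w) {m} c f zero    = trans (sum-cong-≗ (λ j → *-zeroʳ (c j))) (sum-replicate-zero m)
shiftUp-sum (suc w) c f (suc t) = shiftUp-sum w c f t

dilate-cong : ∀ {f g} → (∀ t → f t ≡ g t) → ∀ t → dilate f t ≡ dilate g t
dilate-cong f≗g zero          = f≗g 0
dilate-cong f≗g (suc zero)    = refl
dilate-cong f≗g (suc (suc t)) = dilate-cong (f≗g ∘ suc) t

dilate-0 : ∀ t → dilate 0S t ≡ 0ℚ
dilate-0 zero          = refl
dilate-0 (suc zero)    = refl
dilate-0 (suc (suc t)) = dilate-0 t

dilate-linear : ∀ c f g t → dilate (λ s → c * f s + g s) t ≡ c * dilate f t + dilate g t
dilate-linear c f g zero          = refl
dilate-linear c f g (suc zero)    = sym (trans (+-identityʳ _) (*-zeroʳ c))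
dilate-linear c f g (suc (suc t)) = dilate-linear c (f ∘ suc) (g ∘ suc) t

dilate-sum : ∀ {m} (c : Fin m → ℚ) (f : Fin m → Series) t →
  sum (λ j → c j * dilate (f j) t) ≡ dilate (λ s → sum (λ j → c j * f j s)) t
dilate-sum {zero}  c f t = sym (dilate-0 t)
dilate-sum {suc m} c f t = trans (cong (c Fin.zero * dilate (f Fin.zero) t +_) (dilate-sum (c ∘ Fin.suc) (f ∘ Fin.suc) t))
  (sym (dilate-linear (c Fin.zero) (f Fin.zero) (λ s → sum (λ j → c (Fin.suc j) * f (Fin.suc j) s)) t))

-- With f = f₀ + x f₁ the product is f₀ g + x f₁ g. Removing x costs two uses of `*S-suc` in the
-- variable y and one in the variable x.
dilate-* : ∀ f g t → (dilate f *S dilate g) t ≡ dilate (f *S g) t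
dilate-* f g zero = refl
dilate-* f g (suc zero) = begin
  0ℚ + f 0 * 0ℚ + 0ℚ * g 0   ≡⟨ cong₂ _+_ (cong (λ q → 0ℚ + q) (*-zeroʳ (f 0))) (*-zeroˡ (g 0)) ⟩
  0ℚ                         ∎
dilate-* f g (suc (suc t)) = begin
  (dilate f *S dilate g) (suc (suc t))
    ≡⟨ *S-suc (dilate f) (dilate g) (suc t) ⟩
  f 0 * dilate (g ∘ suc) t + ((dilate f ∘ suc) *S dilate g) (suc t)
    ≡⟨ cong (f 0 * dilate (g ∘ suc) t +_) (trans (*S-suc (dilate f ∘ suc) (dilate g) t)
         (trans (cong (_+ (dilate (f ∘ suc) *S dilate g) t) (*-zeroˡ (dilate g (suc t)))) (+-identityˡ _))) ⟩
  f 0 * dilate (g ∘ suc) t + (dilate (f ∘ suc) *S dilate g) t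
    ≡⟨ cong (f 0 * dilate (g ∘ suc) t +_) (dilate-* (f ∘ suc) g t) ⟩
  f 0 * dilate (g ∘ suc) t + dilate ((f ∘ suc) *S g) t
    ≡⟨ dilate-linear (f 0) (g ∘ suc) ((f ∘ suc) *S g) t ⟨
  dilate (λ s → f 0 * g (suc s) + ((f ∘ suc) *S g) s) t
    ≡⟨ dilate-cong (λ s → sym (*S-suc f g s)) t ⟩
  dilate ((f *S g) ∘ suc) t
    ∎

dilate-2* : ∀ f n → dilate f (2 ℕ.* n) ≡ f n
dilate-2* f zero    = refl
dilate-2* f (suc n) = trans (cong (dilate f ∘ suc) (ℕ.+-suc n (n ℕ.+ 0))) (dilate-2* (f ∘ suc) n)

dilate-if : ∀ h t → dilate h t ≡ (if (t ℕ.% 2) ℕ.≡ᵇ 0 then h (t ℕ./ 2) else 0ℚ)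
dilate-if h zero          = refl
dilate-if h (suc zero)    = refl
dilate-if h (suc (suc t)) = trans (dilate-if (h ∘ suc) t)
  (cong (λ q → if (t ℕ.% 2) ℕ.≡ᵇ 0 then h q else 0ℚ) (sym (ℕ.m/n≡1+[m∸n]/n {suc (suc t)} {2} (s≤s (s≤s z≤n)))))

expNegHalfX≗ : ∀ t → expNegHalfX t ≡ dilate (λ j → ((- (ℤ.+ 1 / 2)) ^ℚ j) * inv! j) t
expNegHalfX≗ t = sym (dilate-if _ t)

private
  *-if : ∀ b (c x y : ℚ) → c * x ≡ y → c * (if b then x else 0ℚ) ≡ (if b then y else 0ℚ)
  *-if true  c x y eq = eq
  *-if false c x y eq = *-zeroʳ c

at2y-besselI : ∀ n t → at2y (besselI n) t ≡ shiftUp n (dilate (λ j → inv! (n ℕ.+ j) * inv! j)) t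
at2y-besselI n t with t ℕ.<ᵇ n in eq
... | true  = trans (*-zeroʳ (ℕ→ℚ (2 ℕ.^ t)))
                (sym (shiftUp-< _ (ℕ.<ᵇ⇒< t n (subst T (sym eq) _))))
... | false = begin
  ℕ→ℚ (2 ℕ.^ t) * (if (d ℕ.% 2) ℕ.≡ᵇ 0 then ((ℤ.+ 1 / 2) ^ℚ t) * inv! (n ℕ.+ d ℕ./ 2) * inv! (d ℕ./ 2) else 0ℚ)
    ≡⟨ *-if ((d ℕ.% 2) ℕ.≡ᵇ 0) (ℕ→ℚ (2 ℕ.^ t)) (((ℤ.+ 1 / 2) ^ℚ t) * inv! (n ℕ.+ d ℕ./ 2) * inv! (d ℕ./ 2)) (h (d ℕ./ 2)) cancel ⟩
  (if (d ℕ.% 2) ℕ.≡ᵇ 0 then h (d ℕ./ 2) else 0ℚ)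
    ≡⟨ dilate-if h d ⟨
  dilate h d
    ≡⟨ shiftUp-+ n (dilate h) d ⟨
  shiftUp n (dilate h) (n ℕ.+ d)
    ≡⟨ cong (shiftUp n (dilate h)) (ℕ.m+[n∸m]≡n {n} {t} (ℕ.≮⇒≥ (λ t<n → subst T eq (ℕ.<⇒<ᵇ t<n)))) ⟩
  shiftUp n (dilate h) t
    ∎
  where
  d = t ℕ.∸ n
  h : Series
  h j = inv! (n ℕ.+ j) * inv! j
  cancel : ℕ→ℚ (2 ℕ.^ t) * (((ℤ.+ 1 / 2) ^ℚ t) * inv! (n ℕ.+ d ℕ./ 2) * inv! (d ℕ./ 2)) ≡ h (d ℕ./ 2)
  cancel = begin
    ℕ→ℚ (2 ℕ.^ t) * (((ℤ.+ 1 / 2) ^ℚ t) * p * q)   ≡⟨ solve 4 (λ a b c d → a :* (b :* c :* d) := a :* b :* (c :* d)) refl (ℕ→ℚ (2 ℕ.^ t)) ((ℤ.+ 1 / 2) ^ℚ t) p q ⟩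
    ℕ→ℚ (2 ℕ.^ t) * ((ℤ.+ 1 / 2) ^ℚ t) * (p * q)   ≡⟨ cong (_* (p * q)) (2^-inverse t) ⟩
    1ℚ * (p * q)                                 ≡⟨ *-identityˡ _ ⟩
    p * q                                        ∎
    where
    p = inv! (n ℕ.+ d ℕ./ 2)
    q = inv! (d ℕ./ 2)

-- Determinants with rows labelled by numbers and columns given as functions of the row label

Column : Set
Column = ℕ → ℚ

-- `expand` is the Laplace sum along row b: `acc` holds the columns already passed, and the nested
-- subtraction produces the alternating signs. Unequal numbers of rows and columns give 0, so
-- linearity and vanishing hold without hypotheses on lengths.
mutual
  det : List ℕ → List Column → ℚ
  det []       []      = 1ℚ
  det []       (_ ∷ _) = 0ℚ
  det (b ∷ bs) cs      = expand b bs [] cs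

  expand : ℕ → List ℕ → List Column → List Column → ℚ
  expand b bs acc []       = 0ℚ
  expand b bs acc (c ∷ cs) = c b * det bs (acc ++ cs) - expand b bs (acc ++ c ∷ []) cs

-- A relation rather than a position in the list: it passes through `++` on either side, as the
-- accumulator requires. Columns are compared pointwise, which replaces extensionality.
data Combine (q : ℚ) : (xs ys zs : List Column) → Set where
  here  : ∀ {x y z cs} → (∀ b → x b ≡ y b + q * z b) → Combine q (x ∷ cs) (y ∷ cs) (z ∷ cs)
  there : ∀ {c xs ys zs} → Combine q xs ys zs → Combine q (c ∷ xs) (c ∷ ys) (c ∷ zs)

combine-++ˡ : ∀ {q xs ys zs} pre → Combine q xs ys zs → Combine q (pre ++ xs) (pre ++ ys) (pre ++ zs)
combine-++ˡ []        p = p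
combine-++ˡ (c ∷ pre) p = there (combine-++ˡ pre p)

combine-++ʳ : ∀ {q xs ys zs} post → Combine q xs ys zs → Combine q (xs ++ post) (ys ++ post) (zs ++ post)
combine-++ʳ post (here e)  = here e
combine-++ʳ post (there p) = there (combine-++ʳ post p)

mutual
  -- While the row is expanded, the combined column is either still ahead (`expand-combineʳ`) or
  -- already in the accumulator (`expand-combineˡ`). The entry x b is used only when the expansion
  -- reaches that column; all other terms are linear through their minors.
  det-combine : ∀ {q xs ys zs} bs → Combine q xs ys zs → det bs xs ≡ det bs ys + q * det bs zs
  det-combine {q} []   (here _)  = sym (trans (+-identityˡ _) (*-zeroʳ q))
  det-combine {q} []   (there _) = sym (trans (+-identityˡ _) (*-zeroʳ q))
  det-combine (b ∷ bs) p         = expand-combineʳ b bs [] p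

  expand-combineʳ : ∀ {q xs ys zs} b bs acc → Combine q xs ys zs →
    expand b bs acc xs ≡ expand b bs acc ys + q * expand b bs acc zs
  expand-combineʳ {q} b bs acc (here {x} {y} {z} {cs} e) = begin
    x b * D - expand b bs (acc ++ x ∷ []) cs
      ≡⟨ cong₂ (λ u v → u * D - v) (e b) (expand-combineˡ b bs cs (combine-++ˡ {q} acc (here {z = z} e))) ⟩
    (y b + q * z b) * D - (Y + q * Z)
      ≡⟨ solve 6 (λ y q z d Y Z → (y :+ q :* z) :* d :- (Y :+ q :* Z) := y :* d :- Y :+ q :* (z :* d :- Z)) refl (y b) q (z b) D Y Z ⟩
    y b * D - Y + q * (z b * D - Z)
      ∎
    where
    D = det bs (acc ++ cs)
    Y = expand b bs (acc ++ y ∷ []) cs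
    Z = expand b bs (acc ++ z ∷ []) cs
  expand-combineʳ {q} b bs acc (there {c} {xs} {ys} {zs} p) = begin
    c b * det bs (acc ++ xs) - expand b bs (acc ++ c ∷ []) xs
      ≡⟨ cong₂ (λ u v → c b * u - v) (det-combine bs (combine-++ˡ acc p)) (expand-combineʳ b bs (acc ++ c ∷ []) p) ⟩
    c b * (D + q * D′) - (E + q * E′)
      ≡⟨ solve 6 (λ c q d d′ e e′ → c :* (d :+ q :* d′) :- (e :+ q :* e′) := c :* d :- e :+ q :* (c :* d′ :- e′)) refl (c b) q D D′ E E′ ⟩
    c b * D - E + q * (c b * D′ - E′)
      ∎
    where
    D  = det bs (acc ++ ys)
    D′ = det bs (acc ++ zs)
    E  = expand b bs (acc ++ c ∷ []) ys
    E′ = expand b bs (acc ++ c ∷ []) zs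

  expand-combineˡ : ∀ {q xs ys zs} b bs cs → Combine q xs ys zs →
    expand b bs xs cs ≡ expand b bs ys cs + q * expand b bs zs cs
  expand-combineˡ {q} b bs [] p = sym (trans (+-identityˡ _) (*-zeroʳ q))
  expand-combineˡ {q} {xs} {ys} {zs} b bs (c ∷ cs) p = begin
    c b * det bs (xs ++ cs) - expand b bs (xs ++ c ∷ []) cs
      ≡⟨ cong₂ (λ u v → c b * u - v) (det-combine bs (combine-++ʳ cs p)) (expand-combineˡ b bs cs (combine-++ʳ (c ∷ []) p)) ⟩
    c b * (D + q * D′) - (E + q * E′)
      ≡⟨ solve 6 (λ c q d d′ e e′ → c :* (d :+ q :* d′) :- (e :+ q :* e′) := c :* d :- e :+ q :* (c :* d′ :- e′)) refl (c b) q D D′ E E′ ⟩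
    c b * D - E + q * (c b * D′ - E′)
      ∎
    where
    D  = det bs (ys ++ cs)
    D′ = det bs (zs ++ cs)
    E  = expand b bs (ys ++ c ∷ []) cs
    E′ = expand b bs (zs ++ c ∷ []) cs

-- Adjacent repetition suffices, since each column is only ever altered by its right neighbour; no
-- sign of a permutation has to be followed.
data Repeat : List Column → Set where
  here  : ∀ {c cs} → Repeat (c ∷ c ∷ cs)
  there : ∀ {c cs} → Repeat cs → Repeat (c ∷ cs)

repeat-++ˡ : ∀ {cs} pre → Repeat cs → Repeat (pre ++ cs)
repeat-++ˡ []        p = p
repeat-++ˡ (c ∷ pre) p = there (repeat-++ˡ pre p)

repeat-++ʳ : ∀ {cs} post → Repeat cs → Repeat (cs ++ post)
repeat-++ʳ post here      = here
repeat-++ʳ post (there p) = there (repeat-++ʳ post p)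

mutual
  det-repeat : ∀ {cs} bs → Repeat cs → det bs cs ≡ 0ℚ
  det-repeat []       here      = refl
  det-repeat []       (there _) = refl
  det-repeat (b ∷ bs) p         = expand-repeatʳ b bs [] p

  -- The two terms that delete one of the equal neighbours have the same minor and opposite signs.
  -- Every other minor still contains both copies.
  expand-repeatʳ : ∀ {cs} b bs acc → Repeat cs → expand b bs acc cs ≡ 0ℚ
  expand-repeatʳ b bs acc (here {c} {cs}) = begin
    c b * det bs (acc ++ c ∷ cs) - (c b * det bs ((acc ++ c ∷ []) ++ cs) - expand b bs ((acc ++ c ∷ []) ++ c ∷ []) cs)
      ≡⟨ cong₂ (λ l e → c b * D - (c b * det bs l - e)) (++-assoc acc (c ∷ []) cs)
           (expand-repeatˡ b bs cs (subst Repeat (sym (++-assoc acc (c ∷ []) (c ∷ []))) (repeat-++ˡ acc here))) ⟩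
    c b * D - (c b * D - 0ℚ)
      ≡⟨ solve 1 (λ x → x :- (x :- con 0ℚ) := con 0ℚ) refl (c b * D) ⟩
    0ℚ
      ∎
    where D = det bs (acc ++ c ∷ cs)
  expand-repeatʳ b bs acc (there {c} {cs} p) = begin
    c b * det bs (acc ++ cs) - expand b bs (acc ++ c ∷ []) cs
      ≡⟨ cong₂ (λ d e → c b * d - e) (det-repeat bs (repeat-++ˡ acc p)) (expand-repeatʳ b bs (acc ++ c ∷ []) p) ⟩
    c b * 0ℚ - 0ℚ
      ≡⟨ cong (_- 0ℚ) (*-zeroʳ (c b)) ⟩
    0ℚ
      ∎

  expand-repeatˡ : ∀ {acc} b bs cs → Repeat acc → expand b bs acc cs ≡ 0ℚ
  expand-repeatˡ b bs []       p = refl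
  expand-repeatˡ {acc} b bs (c ∷ cs) p = begin
    c b * det bs (acc ++ cs) - expand b bs (acc ++ c ∷ []) cs
      ≡⟨ cong₂ (λ d e → c b * d - e) (det-repeat bs (repeat-++ʳ cs p)) (expand-repeatˡ b bs cs (repeat-++ʳ (c ∷ []) p)) ⟩
    c b * 0ℚ - 0ℚ
      ≡⟨ cong (_- 0ℚ) (*-zeroʳ (c b)) ⟩
    0ℚ
      ∎

det-addColumn : ∀ {q x y z} bs pre post → (∀ b → x b ≡ y b + q * z b) →
  det bs (pre ++ x ∷ z ∷ post) ≡ det bs (pre ++ y ∷ z ∷ post)
det-addColumn {q} {x} {y} {z} bs pre post e = begin
  det bs (pre ++ x ∷ z ∷ post)
    ≡⟨ det-combine bs (combine-++ˡ {q} pre (here {z = z} e)) ⟩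
  D + q * det bs (pre ++ z ∷ z ∷ post)
    ≡⟨ cong (λ d → D + q * d) (det-repeat bs (repeat-++ˡ pre here)) ⟩
  D + q * 0ℚ
    ≡⟨ trans (cong (D +_) (*-zeroʳ q)) (+-identityʳ D) ⟩
  D
    ∎
  where D = det bs (pre ++ y ∷ z ∷ post)

ScaledBy : (ℕ → ℚ) → List Column → List Column → Set
ScaledBy σ = Pointwise (λ x y → ∀ b → x b ≡ σ b * y b)

mutual
  det-scaleRows : ∀ σ {xs ys} bs → ScaledBy σ xs ys → det bs xs ≡ prodL (List.map σ bs) * det bs ys
  det-scaleRows σ []       []      = refl
  det-scaleRows σ []       (_ ∷ _) = refl
  det-scaleRows σ (b ∷ bs) p       = expand-scaleRows σ b bs [] p

  expand-scaleRows : ∀ σ {as as′ xs ys} b bs → ScaledBy σ as as′ → ScaledBy σ xs ys →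
    expand b bs as xs ≡ prodL (List.map σ (b ∷ bs)) * expand b bs as′ ys
  expand-scaleRows σ b bs p [] = sym (*-zeroʳ (prodL (List.map σ (b ∷ bs))))
  expand-scaleRows σ {as} {as′} {x ∷ xs} {y ∷ ys} b bs p (e ∷ q) = begin
    x b * det bs (as ++ xs) - expand b bs (as ++ x ∷ []) xs
      ≡⟨ cong₂ _-_ (cong₂ _*_ (e b) (det-scaleRows σ bs (Pointwise.++⁺ p q)))
                   (expand-scaleRows σ b bs (Pointwise.++⁺ p (e ∷ [])) q) ⟩
    σ b * y b * (P * D) - σ b * P * E
      ≡⟨ solve 5 (λ s y p d e → s :* y :* (p :* d) :- s :* p :* e := s :* p :* (y :* d :- e)) refl (σ b) (y b) P D E ⟩
    σ b * P * (y b * D - E)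
      ∎
    where
    P = prodL (List.map σ bs)
    D = det bs (as′ ++ ys)
    E = expand b bs (as′ ++ y ∷ []) ys

-- The determinant of the matrix of inverse factorials

invCol : ℕ → Column
invCol j b = inv! (b ℕ.+ j)

-- The first index s varies because each reduction replaces the columns by those with the next
-- higher indices.
invCols : ℕ → ℕ → List Column
invCols s zero    = []
invCols s (suc n) = invCol s ∷ invCols (suc s) n

module _ (b₀ : ℕ) where

  -- With b₀ the label of the first row, this is what the column operation leaves of column j: it
  -- vanishes in the first row and elsewhere is a factor of the row times column j + 1.
  reducedCol : ℕ → Column
  reducedCol j b = (ℕ→ℚ b - ℕ→ℚ b₀) * invCol (suc j) b

  reducedCols : ℕ → ℕ → List Column
  reducedCols s zero    = []
  reducedCols s (suc n) = reducedCol s ∷ reducedCols (suc s) n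

  reducedCol-vanishes : ∀ j → reducedCol j b₀ ≡ 0ℚ
  reducedCol-vanishes j = trans (cong (_* invCol (suc j) b₀) (+-inverseʳ (ℕ→ℚ b₀))) (*-zeroˡ (invCol (suc j) b₀))

  -- 1/(b+j)! = (b+j+1)/(b+j+1)!, and b + j + 1 = (b - b₀) + (b₀ + j + 1)
  invCol-reduce : ∀ j b → invCol j b ≡ reducedCol j b + (ℕ→ℚ b₀ + ℕ→ℚ (suc j)) * invCol (suc j) b
  invCol-reduce j b = begin
    inv! (b ℕ.+ j)
      ≡⟨ inv!-suc (b ℕ.+ j) ⟩
    ℕ→ℚ (suc (b ℕ.+ j)) * inv! (suc (b ℕ.+ j))
      ≡⟨ cong (λ k → ℕ→ℚ k * inv! k) (sym (ℕ.+-suc b j)) ⟩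
    ℕ→ℚ (b ℕ.+ suc j) * v
      ≡⟨ cong (_* v) (ℕ→ℚ-+ b (suc j)) ⟩
    (ℕ→ℚ b + ℕ→ℚ (suc j)) * v
      ≡⟨ solve 4 (λ b c j v → (b :+ j) :* v := (b :- c) :* v :+ (c :+ j) :* v) refl (ℕ→ℚ b) (ℕ→ℚ b₀) (ℕ→ℚ (suc j)) v ⟩
    (ℕ→ℚ b - ℕ→ℚ b₀) * v + (ℕ→ℚ b₀ + ℕ→ℚ (suc j)) * v
      ∎
    where v = inv! (b ℕ.+ suc j)

  -- The columns are treated from left to right, so that the neighbour to be subtracted is still in
  -- its original form. The last column, of index T, has no neighbour and stays.
  det-reduce : ∀ bs pre s n {T} → n ℕ.+ s ≡ T →
    det bs (pre ++ invCols s (suc n)) ≡ det bs (pre ++ (reducedCols s n ++ invCol T ∷ []))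
  det-reduce bs pre s zero    refl = refl
  det-reduce bs pre s (suc n) {T} eq = begin
    det bs (pre ++ invCol s ∷ invCols (suc s) (suc n))
      ≡⟨ det-addColumn {ℕ→ℚ b₀ + ℕ→ℚ (suc s)} bs pre (invCols (suc (suc s)) n) (invCol-reduce s) ⟩
    det bs (pre ++ reducedCol s ∷ invCols (suc s) (suc n))
      ≡⟨ cong (det bs) (sym (++-assoc pre (reducedCol s ∷ []) _)) ⟩
    det bs ((pre ++ reducedCol s ∷ []) ++ invCols (suc s) (suc n))
      ≡⟨ det-reduce bs (pre ++ reducedCol s ∷ []) (suc s) n (trans (ℕ.+-suc n s) eq) ⟩
    det bs ((pre ++ reducedCol s ∷ []) ++ (reducedCols (suc s) n ++ invCol T ∷ []))
      ≡⟨ cong (det bs) (++-assoc pre (reducedCol s ∷ []) _) ⟩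
    det bs (pre ++ (reducedCols s (suc n) ++ invCol T ∷ []))
      ∎

  -- All reduced columns vanish at b₀, so only the last column contributes, after n changes of sign.
  expand-reduced : ∀ bs acc s n c →
    expand b₀ bs acc (reducedCols s n ++ c ∷ []) ≡ ((- 1ℚ) ^ℚ n) * (c b₀ * det bs (acc ++ reducedCols s n))
  expand-reduced bs acc s zero c =
    solve 1 (λ x → x :- con 0ℚ := con 1ℚ :* x) refl (c b₀ * det bs (acc ++ []))
  expand-reduced bs acc s (suc n) c = begin
    r b₀ * det bs (acc ++ (reducedCols (suc s) n ++ c ∷ [])) - expand b₀ bs (acc ++ r ∷ []) (reducedCols (suc s) n ++ c ∷ [])
      ≡⟨ cong₂ _-_ (trans (cong (_* det bs (acc ++ (reducedCols (suc s) n ++ c ∷ []))) (reducedCol-vanishes s)) (*-zeroˡ (det bs (acc ++ (reducedCols (suc s) n ++ c ∷ [])))))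
           (expand-reduced bs (acc ++ r ∷ []) (suc s) n c) ⟩
    0ℚ - S * (c b₀ * det bs ((acc ++ r ∷ []) ++ reducedCols (suc s) n))
      ≡⟨ cong (λ l → 0ℚ - S * (c b₀ * det bs l)) (++-assoc acc (r ∷ []) _) ⟩
    0ℚ - S * (c b₀ * D)
      ≡⟨ solve 2 (λ s d → con 0ℚ :- s :* d := (:- con 1ℚ) :* s :* d) refl S (c b₀ * D) ⟩
    (- 1ℚ) * S * (c b₀ * D)
      ∎
    where
    r = reducedCol s
    S = (- 1ℚ) ^ℚ n
    D = det bs (acc ++ r ∷ reducedCols (suc s) n)

  reduced-scaled : ∀ s n → ScaledBy (λ b → ℕ→ℚ b - ℕ→ℚ b₀) (reducedCols s n) (invCols (suc s) n)
  reduced-scaled s zero    = []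
  reduced-scaled s (suc n) = (λ _ → refl) ∷ reduced-scaled (suc s) n

  prod-flip : ∀ bs → ((- 1ℚ) ^ℚ length bs) * prodL (List.map (λ b → ℕ→ℚ b - ℕ→ℚ b₀) bs)
                   ≡ prodL (List.map (λ b → ℕ→ℚ b₀ - ℕ→ℚ b) bs)
  prod-flip []       = refl
  prod-flip (b ∷ bs) = begin
    (- 1ℚ) * S * ((ℕ→ℚ b - ℕ→ℚ b₀) * P)
      ≡⟨ solve 4 (λ s b c p → (:- con 1ℚ) :* s :* ((b :- c) :* p) := (c :- b) :* (s :* p)) refl S (ℕ→ℚ b) (ℕ→ℚ b₀) P ⟩
    (ℕ→ℚ b₀ - ℕ→ℚ b) * (S * P)
      ≡⟨ cong ((ℕ→ℚ b₀ - ℕ→ℚ b) *_) (prod-flip bs) ⟩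
    (ℕ→ℚ b₀ - ℕ→ℚ b) * prodL (List.map (λ b → ℕ→ℚ b₀ - ℕ→ℚ b) bs)
      ∎
    where
    S = (- 1ℚ) ^ℚ length bs
    P = prodL (List.map (λ b → ℕ→ℚ b - ℕ→ℚ b₀) bs)

vandermonde : List ℕ → ℚ
vandermonde []       = 1ℚ
vandermonde (b ∷ bs) = prodL (List.map (λ b′ → ℕ→ℚ b - ℕ→ℚ b′) bs) * vandermonde bs

-- Each step removes a row and raises s by one, so the index T of the last column never changes.
-- This is why every row contributes its factorial with the same T.
det-invCols : ∀ bs s T → length bs ℕ.+ s ≡ suc T →
  det bs (invCols s (length bs)) ≡ prodL (List.map (λ b → inv! (b ℕ.+ T)) bs) * vandermonde bs
det-invCols []       s T eq = refl
det-invCols (b ∷ bs) s T eq = begin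
  det (b ∷ bs) (invCols s (suc n))
    ≡⟨ det-reduce b (b ∷ bs) [] s n (ℕ.suc-injective eq) ⟩
  expand b bs [] (reducedCols b s n ++ invCol T ∷ [])
    ≡⟨ expand-reduced b bs [] s n (invCol T) ⟩
  S * (v * det bs (reducedCols b s n))
    ≡⟨ cong (λ d → S * (v * d)) (det-scaleRows _ bs (reduced-scaled b s n)) ⟩
  S * (v * (P * det bs (invCols (suc s) n)))
    ≡⟨ cong (λ d → S * (v * (P * d))) (det-invCols bs (suc s) T (trans (ℕ.+-suc n s) eq)) ⟩
  S * (v * (P * (F * V)))
    ≡⟨ solve 5 (λ s v p f w → s :* (v :* (p :* (f :* w))) := v :* f :* (s :* p :* w)) refl S v P F V ⟩
  v * F * (S * P * V)
    ≡⟨ cong (λ q → v * F * (q * V)) (prod-flip b bs) ⟩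
  v * F * (prodL (List.map (λ b′ → ℕ→ℚ b - ℕ→ℚ b′) bs) * V)
    ∎
  where
  n = length bs
  S = (- 1ℚ) ^ℚ n
  v = inv! (b ℕ.+ T)
  P = prodL (List.map (λ b′ → ℕ→ℚ b′ - ℕ→ℚ b) bs)
  F = prodL (List.map (λ b → inv! (b ℕ.+ T)) bs)
  V = vandermonde bs

-- Laplace expansion of detS

Matrix : ℕ → Set
Matrix n = Fin n → Fin n → Series

minor : ∀ {n} → Matrix (suc n) → Fin (suc n) → Matrix n
minor M j a b = M (Fin.suc a) (punchIn j b)

laplace : ∀ n → Matrix (suc n) → Fin (suc n) → Series
laplace n M j t = ((- 1ℚ) ^ℚ toℕ j) * (M Fin.zero j *S detS n (minor M j)) t

-- The local function `go` of detS has no name outside Defs.  After two unfoldings it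
-- occurs with arguments that can all be abstracted to distinct variables, so that
-- unification finds it as the value of `partialDet`.
mutual
  detRest : ∀ n → Matrix (suc (suc n)) → Series
  detRest n M t = _

  detS-detRest : ∀ n M t → detS (suc (suc n)) M t ≡
    laplace (suc n) M Fin.zero t + (laplace (suc n) M (Fin.suc Fin.zero) t + detRest n M t)
  detS-detRest n M t = refl

mutual
  partialDet : ∀ n → Matrix (suc n) → ∀ m → (Fin m → Fin (suc n)) → Series
  partialDet n M m ι t = _

  detRest-partialDet : ∀ n M t → detRest n M t ≡ partialDet (suc n) M n (λ a → Fin.suc (Fin.suc a)) t
  detRest-partialDet n M t with suc n | (λ (a : Fin n) → Fin.suc (Fin.suc a))
  ... | _ | _ = refl

partialDet-sum : ∀ n M m ι t → partialDet n M m ι t ≡ sum {m} (λ a → laplace n M (ι a) t)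
partialDet-sum n M zero    ι t = refl
partialDet-sum n M (suc m) ι t =
  cong (laplace n M (ι Fin.zero) t +_) (partialDet-sum n M m (ι ∘ Fin.suc) t)

detS-laplace : ∀ n M t → detS (suc n) M t ≡ sum (λ j → laplace n M j t)
detS-laplace n M t = partialDet-sum n M (suc n) (λ j → j) t

-- Deleting the first row and column j removes the weight u 0 + v j, and the minor carries exactly
-- the rest. All Laplace terms therefore share the power y^W, whatever j is.
detS-shiftUp-dilate : ∀ n (M N : Matrix n) (u v : Fin n → ℕ) →
  (∀ a j t → M a j t ≡ shiftUp (u a ℕ.+ v j) (dilate (N a j)) t) →
  ∀ t → detS n M t ≡ shiftUp (ℕΣ.sum u ℕ.+ ℕΣ.sum v) (dilate (detS n N)) t
detS-shiftUp-dilate zero    M N u v M≗ zero          = refl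
detS-shiftUp-dilate zero    M N u v M≗ (suc zero)    = refl
detS-shiftUp-dilate zero    M N u v M≗ (suc (suc t)) = sym (dilate-0 t)
detS-shiftUp-dilate (suc n) M N u v M≗ t = begin
  detS (suc n) M t
    ≡⟨ detS-laplace n M t ⟩
  sum (λ j → ε j * (M Fin.zero j *S detS n (minor M j)) t)
    ≡⟨ sum-cong-≗ (λ j → cong (ε j *_) (term j)) ⟩
  sum (λ j → ε j * shiftUp W (dilate (N Fin.zero j *S detS n (minor N j))) t)
    ≡⟨ shiftUp-sum W ε (λ j → dilate (N Fin.zero j *S detS n (minor N j))) t ⟩
  shiftUp W (λ s → sum (λ j → ε j * dilate (N Fin.zero j *S detS n (minor N j)) s)) t
    ≡⟨ shiftUp-cong W (dilate-sum ε (λ j → N Fin.zero j *S detS n (minor N j))) t ⟩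
  shiftUp W (dilate (λ s → sum (λ j → laplace n N j s))) t
    ≡⟨ shiftUp-cong W (dilate-cong (λ s → sym (detS-laplace n N s))) t ⟩
  shiftUp W (dilate (detS (suc n) N)) t
    ∎
  where
  ε : Fin (suc n) → ℚ
  ε j = (- 1ℚ) ^ℚ toℕ j
  W = ℕΣ.sum u ℕ.+ ℕΣ.sum v
  u′ = u ∘ Fin.suc
  weight : ∀ j → u Fin.zero ℕ.+ v j ℕ.+ (ℕΣ.sum u′ ℕ.+ ℕΣ.sum (v ∘ punchIn j)) ≡ W
  weight j = begin
    u Fin.zero ℕ.+ v j ℕ.+ (ℕΣ.sum u′ ℕ.+ ℕΣ.sum (v ∘ punchIn j))
      ≡⟨ rearrange (u Fin.zero) (v j) (ℕΣ.sum u′) (ℕΣ.sum (v ∘ punchIn j)) ⟩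
    u Fin.zero ℕ.+ ℕΣ.sum u′ ℕ.+ (v j ℕ.+ ℕΣ.sum (v ∘ punchIn j))
      ≡⟨ cong (u Fin.zero ℕ.+ ℕΣ.sum u′ ℕ.+_) (sym (ℕΣ.sum-remove {i = j} v)) ⟩
    W ∎
    where
    rearrange : ∀ a b c d → a ℕ.+ b ℕ.+ (c ℕ.+ d) ≡ a ℕ.+ c ℕ.+ (b ℕ.+ d)
    rearrange = solve-∀
  term : ∀ j → (M Fin.zero j *S detS n (minor M j)) t ≡ shiftUp W (dilate (N Fin.zero j *S detS n (minor N j))) t
  term j = begin
    (M Fin.zero j *S detS n (minor M j)) t
      ≡⟨ *S-cong (M≗ Fin.zero j)
           (detS-shiftUp-dilate n (minor M j) (minor N j) u′ (v ∘ punchIn j) (λ a b → M≗ (Fin.suc a) (punchIn j b))) t ⟩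
    (shiftUp w₁ (dilate (N Fin.zero j)) *S shiftUp w₂ (dilate (detS n (minor N j)))) t
      ≡⟨ shiftUp-* w₁ w₂ (dilate (N Fin.zero j)) (dilate (detS n (minor N j))) t ⟩
    shiftUp (w₁ ℕ.+ w₂) (dilate (N Fin.zero j) *S dilate (detS n (minor N j))) t
      ≡⟨ shiftUp-cong (w₁ ℕ.+ w₂) (dilate-* (N Fin.zero j) (detS n (minor N j))) t ⟩
    shiftUp (w₁ ℕ.+ w₂) (dilate (N Fin.zero j *S detS n (minor N j))) t
      ≡⟨ cong (λ w → shiftUp w (dilate (N Fin.zero j *S detS n (minor N j))) t) (weight j) ⟩
    shiftUp W (dilate (N Fin.zero j *S detS n (minor N j))) t
      ∎
    where
    w₁ = u Fin.zero ℕ.+ v j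
    w₂ = ℕΣ.sum u′ ℕ.+ ℕΣ.sum (v ∘ punchIn j)

-- Sums over compositions

sumL-++ : ∀ xs ys → sumL (xs ++ ys) ≡ sumL xs + sumL ys
sumL-++ []       ys = sym (+-identityˡ (sumL ys))
sumL-++ (x ∷ xs) ys = trans (cong (x +_) (sumL-++ xs ys)) (sym (+-assoc x (sumL xs) (sumL ys)))

ΣC : ∀ p → ℕ → (Vec ℕ p → ℚ) → ℚ
ΣC p s f = sumL (List.map f (compositions p s))

ΣC-suc : ∀ p s f → ΣC (suc p) s f ≡ Σ< (suc s) (λ a → ΣC p (s ℕ.∸ a) (λ v → f (a ∷ v)))
ΣC-suc p s f = go (suc s) (λ a → a)
  where
  -- The tail of `upTo` is no longer an `upTo`, so the induction runs over `applyUpTo` with an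
  -- arbitrary ι.
  go : ∀ n (ι : ℕ → ℕ) →
    sumL (List.map f (concatMap (λ a → List.map (a ∷_) (compositions p (s ℕ.∸ a))) (applyUpTo ι n)))
      ≡ Σ< n (λ i → ΣC p (s ℕ.∸ ι i) (λ v → f (ι i ∷ v)))
  go zero    ι = refl
  go (suc n) ι = begin
    sumL (List.map f (block (ι 0) ++ concatMap block (applyUpTo (ι ∘ suc) n)))
      ≡⟨ cong sumL (map-++ f (block (ι 0)) (concatMap block (applyUpTo (ι ∘ suc) n))) ⟩
    sumL (List.map f (block (ι 0)) ++ List.map f (concatMap block (applyUpTo (ι ∘ suc) n)))
      ≡⟨ sumL-++ (List.map f (block (ι 0))) _ ⟩
    sumL (List.map f (block (ι 0))) + sumL (List.map f (concatMap block (applyUpTo (ι ∘ suc) n)))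
      ≡⟨ cong₂ _+_ (cong sumL (sym (map-∘ (compositions p (s ℕ.∸ ι 0))))) (go n (ι ∘ suc)) ⟩
    g 0 + Σ< n (g ∘ suc)
      ≡⟨ Σ<-head n g ⟨
    Σ< (suc n) g
      ∎
    where
    block : ℕ → List (Vec ℕ (suc p))
    block a = List.map (a ∷_) (compositions p (s ℕ.∸ a))
    g : ℕ → ℚ
    g i = ΣC p (s ℕ.∸ ι i) (λ v → f (ι i ∷ v))

ΣC-cong : ∀ p s {f g} → (∀ v → f v ≡ g v) → ΣC p s f ≡ ΣC p s g
ΣC-cong p s f≗g = cong sumL (map-cong f≗g (compositions p s))

ΣC-*ˡ : ∀ p s c f → c * ΣC p s f ≡ ΣC p s (λ v → c * f v)
ΣC-*ˡ p s c f = go (compositions p s)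
  where
  go : ∀ vs → c * sumL (List.map f vs) ≡ sumL (List.map (λ v → c * f v) vs)
  go []       = *-zeroʳ c
  go (v ∷ vs) = trans (*-distribˡ-+ c (f v) (sumL (List.map f vs))) (cong (c * f v +_) (go vs))

ΣC-sum : ∀ p s {m} (f : Fin m → Vec ℕ p → ℚ) → sum (λ j → ΣC p s (f j)) ≡ ΣC p s (λ v → sum (λ j → f j v))
ΣC-sum p s {m} f = go (compositions p s)
  where
  go : ∀ vs → sum (λ j → sumL (List.map (f j) vs)) ≡ sumL (List.map (λ v → sum (λ j → f j v)) vs)
  go []       = sum-replicate-zero m
  go (v ∷ vs) = trans (∑-distrib-+ (λ j → f j v) (λ j → sumL (List.map (f j) vs)))
    (cong (sum (λ j → f j v) +_) (go vs))

-- `compositions` splits off the first entry, but the first row of the matrix belongs to the last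
-- one. By induction the last entry can be split off behind the first, and `Σ<-triangle` exchanges
-- the two sums.
ΣC-∷ʳ : ∀ p s f → ΣC (suc p) s f ≡ Σ< (suc s) (λ a → ΣC p (s ℕ.∸ a) (λ v → f (v ∷ʳ a)))
ΣC-∷ʳ zero    s f = trans (ΣC-suc zero s f) (Σ<-cong′ (suc s) (λ a → ΣC-cong zero (s ℕ.∸ a) (λ where [] → refl)))
ΣC-∷ʳ (suc p) s f = begin
  ΣC (suc (suc p)) s f
    ≡⟨ ΣC-suc (suc p) s f ⟩
  Σ< (suc s) (λ a → ΣC (suc p) (s ℕ.∸ a) (λ v → f (a ∷ v)))
    ≡⟨ Σ<-cong (suc s) (λ a a<1+s → trans (ΣC-∷ʳ p (s ℕ.∸ a) (λ v → f (a ∷ v)))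
         (cong (λ k → Σ< k (g a)) (1+s∸ a<1+s))) ⟩
  Σ< (suc s) (λ a → Σ< (suc s ℕ.∸ a) (g a))
    ≡⟨ Σ<-triangle (suc s) g ⟩
  Σ< (suc s) (λ b → Σ< (suc s ℕ.∸ b) (λ a → g a b))
    ≡⟨ Σ<-cong (suc s) (λ b b<1+s → sym (trans (ΣC-suc p (s ℕ.∸ b) (λ v → f (v ∷ʳ b)))
         (trans (cong (λ k → Σ< k (h b)) (1+s∸ b<1+s)) (Σ<-cong′ (suc s ℕ.∸ b) (h≗g b))))) ⟩
  Σ< (suc s) (λ b → ΣC (suc p) (s ℕ.∸ b) (λ v → f (v ∷ʳ b)))
    ∎
  where
  g h : ℕ → ℕ → ℚ
  g a b = ΣC p (s ℕ.∸ a ℕ.∸ b) (λ v → f (a ∷ (v ∷ʳ b)))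
  h b a = ΣC p (s ℕ.∸ b ℕ.∸ a) (λ v → f (a ∷ (v ∷ʳ b)))
  1+s∸ : ∀ {a} → a < suc s → suc (s ℕ.∸ a) ≡ suc s ℕ.∸ a
  1+s∸ a<1+s = sym (ℕ.+-∸-assoc 1 (ℕ.s≤s⁻¹ a<1+s))
  h≗g : ∀ b a → h b a ≡ g a b
  h≗g b a = cong (λ k → ΣC p k (λ v → f (a ∷ (v ∷ʳ b)))) (begin
    s ℕ.∸ b ℕ.∸ a    ≡⟨ ℕ.∸-+-assoc s b a ⟩
    s ℕ.∸ (b ℕ.+ a)  ≡⟨ cong (s ℕ.∸_) (ℕ.+-comm b a) ⟩
    s ℕ.∸ (a ℕ.+ b)  ≡⟨ ℕ.∸-+-assoc s a b ⟨
    s ℕ.∸ a ℕ.∸ b    ∎)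

-- Row labels of a composition

entryAt : ∀ {p} → ℕ → Vec ℕ p → ℕ
entryAt _       []      = 0
entryAt zero    (x ∷ _) = x
entryAt (suc i) (_ ∷ v) = entryAt i v

entryAt-∷ʳ-< : ∀ {p} (v : Vec ℕ p) a {i} → i < p → entryAt i (v ∷ʳ a) ≡ entryAt i v
entryAt-∷ʳ-< (x ∷ v) a {zero}  _         = refl
entryAt-∷ʳ-< (x ∷ v) a {suc i} (s≤s i<p) = entryAt-∷ʳ-< v a i<p

entryAt-∷ʳ : ∀ {p} (v : Vec ℕ p) a → entryAt p (v ∷ʳ a) ≡ a
entryAt-∷ʳ []      a = refl
entryAt-∷ʳ (x ∷ v) a = entryAt-∷ʳ v a

applyDownFrom-cong : ∀ {A : Set} {f g : ℕ → A} n → (∀ i → i < n → f i ≡ g i) → applyDownFrom f n ≡ applyDownFrom g n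
applyDownFrom-cong zero    f≗g = refl
applyDownFrom-cong (suc n) f≗g = cong₂ _∷_ (f≗g n ℕ.≤-refl) (applyDownFrom-cong n (λ i i<n → f≗g i (ℕ.m<n⇒m<1+n i<n)))

-- Entry i of the vector is m_{i+1}; the m_i run against the rows of the matrix, so the last entry belongs to the first row.
rowLabels : ∀ {n} → ℕ → Vec ℕ n → List ℕ
rowLabels {n} u v = applyDownFrom (λ i → (u ℕ.+ n ℕ.∸ suc i) ℕ.+ entryAt i v) n

-- `applyDownFrom` begins with the greatest index, so an entry appended to the vector becomes the
-- top row. The other entries keep their indices, and the greater length moves their offset from u
-- to suc u.
rowLabels-∷ʳ : ∀ {n} u (v : Vec ℕ n) a → rowLabels u (v ∷ʳ a) ≡ (u ℕ.+ a) ∷ rowLabels (suc u) v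
rowLabels-∷ʳ {n} u v a = cong₂ _∷_
  (cong₂ ℕ._+_ (ℕ.m+n∸n≡m u (suc n)) (entryAt-∷ʳ v a))
  (applyDownFrom-cong n (λ i i<n → cong₂ ℕ._+_ (cong (ℕ._∸ suc i) (ℕ.+-suc u n)) (entryAt-∷ʳ-< v a i<n)))

prodInv! : ∀ {p} → Vec ℕ p → ℚ
prodInv! v = prodL (Vec.toList (Vec.map inv! v))

prodInv!-∷ʳ : ∀ {p} (v : Vec ℕ p) a → prodInv! (v ∷ʳ a) ≡ inv! a * prodInv! v
prodInv!-∷ʳ []      a = refl
prodInv!-∷ʳ (x ∷ v) a = trans (cong (inv! x *_) (prodInv!-∷ʳ v a))
  (solve 3 (λ x a p → x :* (a :* p) := a :* (x :* p)) refl (inv! x) (inv! a) (prodInv! v))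

-- Coefficients of a determinant of series

expand-tabulate : ∀ b bs acc {n} (κ : Fin (suc n) → Column) →
  expand b bs acc (tabulate κ) ≡
  sum (λ j → ((- 1ℚ) ^ℚ toℕ j) * (κ j b * det bs (acc ++ tabulate (κ ∘ punchIn j))))
expand-tabulate b bs acc {zero} κ =
  solve 1 (λ x → x :- con 0ℚ := con 1ℚ :* x :+ con 0ℚ) refl (κ Fin.zero b * det bs (acc ++ []))
expand-tabulate b bs acc {suc n} κ = begin
  X - expand b bs (acc ++ κ Fin.zero ∷ []) (tabulate κ′)
    ≡⟨ cong (λ e → X - e) (expand-tabulate b bs (acc ++ κ Fin.zero ∷ []) κ′) ⟩
  X - sum f
    ≡⟨ solve 2 (λ x s → x :- s := con 1ℚ :* x :+ (:- con 1ℚ) :* s) refl X (sum f) ⟩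
  1ℚ * X + (- 1ℚ) * sum f
    ≡⟨ cong (1ℚ * X +_) (trans (*-distribˡ-sum (- 1ℚ) f) (sum-cong-≗ step)) ⟩
  1ℚ * X + sum (λ j → ((- 1ℚ) ^ℚ suc (toℕ j)) * (κ′ j b * det bs (acc ++ κ Fin.zero ∷ tabulate (κ′ ∘ punchIn j))))
    ∎
  where
  κ′ : Fin (suc n) → Column
  κ′ = κ ∘ Fin.suc
  X = κ Fin.zero b * det bs (acc ++ tabulate κ′)
  f : Fin (suc n) → ℚ
  f j = ((- 1ℚ) ^ℚ toℕ j) * (κ′ j b * det bs ((acc ++ κ Fin.zero ∷ []) ++ tabulate (κ′ ∘ punchIn j)))
  step : ∀ j → (- 1ℚ) * f j ≡ ((- 1ℚ) ^ℚ suc (toℕ j)) * (κ′ j b * det bs (acc ++ κ Fin.zero ∷ tabulate (κ′ ∘ punchIn j)))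
  step j = trans (sym (*-assoc (- 1ℚ) ((- 1ℚ) ^ℚ toℕ j) _))
    (cong (λ l → ((- 1ℚ) ^ℚ suc (toℕ j)) * (κ′ j b * det bs l)) (++-assoc acc (κ Fin.zero ∷ []) _))

-- The degree a taken from the first row can be fixed before the column j is chosen. After this
-- exchange of sums, the sum over j for each a is the expansion of a numerical determinant with
-- first label u + a. The columns κ are arbitrary because the minors omit some of them.
detS-coefficient : ∀ n u (κ : Fin n → Column) (N : Matrix n) →
  (∀ a j l → N a j l ≡ inv! l * κ j (u ℕ.+ toℕ a ℕ.+ l)) →
  ∀ s → detS n N s ≡ ΣC n s (λ v → prodInv! v * det (rowLabels u v) (tabulate κ))
detS-coefficient zero    u κ N N≗ zero    = refl
detS-coefficient zero    u κ N N≗ (suc s) = refl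
detS-coefficient (suc n) u κ N N≗ s = begin
  detS (suc n) N s
    ≡⟨ detS-laplace n N s ⟩
  sum (λ j → laplace n N j s)
    ≡⟨ sum-cong-≗ step ⟩
  sum (λ j → Σ< (suc s) (λ a → ΣC n (s ℕ.∸ a) (F j a)))
    ≡⟨ Σ<-sum (suc s) (λ j a → ΣC n (s ℕ.∸ a) (F j a)) ⟩
  Σ< (suc s) (λ a → sum (λ j → ΣC n (s ℕ.∸ a) (F j a)))
    ≡⟨ Σ<-cong′ (suc s) (λ a → trans (ΣC-sum n (s ℕ.∸ a) (λ j → F j a)) (ΣC-cong n (s ℕ.∸ a) (collect a))) ⟩
  Σ< (suc s) (λ a → ΣC n (s ℕ.∸ a) (λ v → G (v ∷ʳ a)))
    ≡⟨ ΣC-∷ʳ n s G ⟨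
  ΣC (suc n) s G
    ∎
  where
  G : Vec ℕ (suc n) → ℚ
  G v = prodInv! v * det (rowLabels u v) (tabulate κ)
  ε : Fin (suc n) → ℚ
  ε j = (- 1ℚ) ^ℚ toℕ j
  D : Fin (suc n) → Vec ℕ n → ℚ
  D j v = det (rowLabels (suc u) v) (tabulate (κ ∘ punchIn j))
  F : Fin (suc n) → ℕ → Vec ℕ n → ℚ
  F j a v = ε j * (inv! a * κ j (u ℕ.+ a) * (prodInv! v * D j v))
  step : ∀ j → laplace n N j s ≡ Σ< (suc s) (λ a → ΣC n (s ℕ.∸ a) (F j a))
  step j = begin
    ε j * Σ< (suc s) (λ a → N Fin.zero j a * detS n (minor N j) (s ℕ.∸ a))
      ≡⟨ Σ<-*ˡ (suc s) (ε j) (λ a → N Fin.zero j a * detS n (minor N j) (s ℕ.∸ a)) ⟩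
    Σ< (suc s) (λ a → ε j * (N Fin.zero j a * detS n (minor N j) (s ℕ.∸ a)))
      ≡⟨ Σ<-cong′ (suc s) (λ a → begin
           ε j * (N Fin.zero j a * detS n (minor N j) (s ℕ.∸ a))
             ≡⟨ cong₂ (λ x y → ε j * (x * y))
                  (trans (N≗ Fin.zero j a) (cong (λ k → inv! a * κ j (k ℕ.+ a)) (ℕ.+-identityʳ u)))
                  (detS-coefficient n (suc u) (κ ∘ punchIn j) (minor N j)
                    (λ i b l → trans (N≗ (Fin.suc i) (punchIn j b) l)
                      (cong (λ k → inv! l * κ (punchIn j b) (k ℕ.+ l)) (ℕ.+-suc u (toℕ i))))
                    (s ℕ.∸ a)) ⟩
           ε j * (c j a * ΣC n (s ℕ.∸ a) (λ v → prodInv! v * D j v))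
             ≡⟨ cong (ε j *_) (ΣC-*ˡ n (s ℕ.∸ a) (c j a) (λ v → prodInv! v * D j v)) ⟩
           ε j * ΣC n (s ℕ.∸ a) (λ v → c j a * (prodInv! v * D j v))
             ≡⟨ ΣC-*ˡ n (s ℕ.∸ a) (ε j) (λ v → c j a * (prodInv! v * D j v)) ⟩
           ΣC n (s ℕ.∸ a) (F j a)
             ∎) ⟩
    Σ< (suc s) (λ a → ΣC n (s ℕ.∸ a) (F j a))
      ∎
    where
    c : Fin (suc n) → ℕ → ℚ
    c j a = inv! a * κ j (u ℕ.+ a)
  collect : ∀ a v → sum (λ j → F j a v) ≡ G (v ∷ʳ a)
  collect a v = begin
    sum (λ j → F j a v)
      ≡⟨ sum-cong-≗ (λ j → solve 5 (λ e i k p d → e :* (i :* k :* (p :* d)) := i :* p :* (e :* (k :* d))) refl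
           (ε j) (inv! a) (κ j (u ℕ.+ a)) (prodInv! v) (D j v)) ⟩
    sum (λ j → inv! a * prodInv! v * (ε j * (κ j (u ℕ.+ a) * D j v)))
      ≡⟨ *-distribˡ-sum (inv! a * prodInv! v) (λ j → ε j * (κ j (u ℕ.+ a) * D j v)) ⟨
    inv! a * prodInv! v * sum (λ j → ε j * (κ j (u ℕ.+ a) * D j v))
      ≡⟨ cong (inv! a * prodInv! v *_) (sym (expand-tabulate (u ℕ.+ a) (rowLabels (suc u) v) [] κ)) ⟩
    inv! a * prodInv! v * det ((u ℕ.+ a) ∷ rowLabels (suc u) v) (tabulate κ)
      ≡⟨ cong₂ (λ p bs → p * det bs (tabulate κ)) (sym (prodInv!-∷ʳ v a)) (sym (rowLabels-∷ʳ u v a)) ⟩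
    G (v ∷ʳ a)
      ∎

-- Products over initial segments

Π< : ℕ → (ℕ → ℚ) → ℚ
Π< zero    f = 1ℚ
Π< (suc n) f = f n * Π< n f

Π<-cong : ∀ n {f g} → (∀ i → i < n → f i ≡ g i) → Π< n f ≡ Π< n g
Π<-cong zero    f≗g = refl
Π<-cong (suc n) f≗g = cong₂ _*_ (f≗g n ℕ.≤-refl) (Π<-cong n (λ i i<n → f≗g i (ℕ.m<n⇒m<1+n i<n)))

Π<-head : ∀ n f → Π< (suc n) f ≡ f 0 * Π< n (f ∘ suc)
Π<-head zero    f = refl
Π<-head (suc n) f = trans (cong (f (suc n) *_) (Π<-head n f))
  (solve 3 (λ x y p → x :* (y :* p) := y :* (x :* p)) refl (f (suc n)) (f 0) (Π< n (f ∘ suc)))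

prodL-applyUpTo : ∀ f n → prodL (applyUpTo f n) ≡ Π< n f
prodL-applyUpTo f zero    = refl
prodL-applyUpTo f (suc n) = trans (cong (f 0 *_) (prodL-applyUpTo (f ∘ suc) n)) (sym (Π<-head n f))

prodL-upTo : ∀ f n → prodL (List.map f (List.map suc (upTo n))) ≡ Π< n (f ∘ suc)
prodL-upTo f n = begin
  prodL (List.map f (List.map suc (upTo n)))  ≡⟨ cong (prodL ∘ List.map f) (map-upTo suc n) ⟩
  prodL (List.map f (applyUpTo suc n))        ≡⟨ cong prodL (map-applyUpTo suc f n) ⟩
  prodL (applyUpTo (f ∘ suc) n)               ≡⟨ prodL-applyUpTo (f ∘ suc) n ⟩
  Π< n (f ∘ suc)                              ∎

prodL-++ : ∀ xs ys → prodL (xs ++ ys) ≡ prodL xs * prodL ys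
prodL-++ []       ys = sym (*-identityˡ (prodL ys))
prodL-++ (x ∷ xs) ys = trans (cong (x *_) (prodL-++ xs ys)) (sym (*-assoc x (prodL xs) (prodL ys)))

prodL-concatMap : ∀ {A : Set} (f : A → List ℚ) xs → prodL (concatMap f xs) ≡ prodL (List.map (prodL ∘ f) xs)
prodL-concatMap f []       = refl
prodL-concatMap f (x ∷ xs) = trans (prodL-++ (f x) (concatMap f xs)) (cong (prodL (f x) *_) (prodL-concatMap f xs))

prodL-applyDownFrom : ∀ (f : ℕ → ℚ) g n → prodL (List.map f (applyDownFrom g n)) ≡ Π< n (f ∘ g)
prodL-applyDownFrom f g zero    = refl
prodL-applyDownFrom f g (suc n) = cong (f (g n) *_) (prodL-applyDownFrom f g n)

-- In a list running downwards, earlier minus later means greater index minus smaller index, which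
-- is the orientation of the formula.
vandermonde-applyDownFrom : ∀ g n →
  vandermonde (applyDownFrom g n) ≡ Π< n (λ j → Π< j (λ i → ℕ→ℚ (g j) - ℕ→ℚ (g i)))
vandermonde-applyDownFrom g zero    = refl
vandermonde-applyDownFrom g (suc n) =
  cong₂ _*_ (prodL-applyDownFrom (λ b → ℕ→ℚ (g n) - ℕ→ℚ b) g n) (vandermonde-applyDownFrom g n)

-- The summand of the formula

-- `entry` and `entryOf` name the local functions `mi` and `go` of summand, in the same way as `partialDet`.
mutual
  entry : ∀ k → Vec ℕ (suc k) → ℕ → ℕ
  entry k m i = _

  summand-entry : ∀ k m → summand k m ≡
    multinomial (2 ℕ.* k) m
    * ((- (ℤ.+ 1 / 2)) ^ℚ Vec.head m)
    * prodL (List.map (λ i → inv! ((2 ℕ.* k ℕ.∸ i) ℕ.+ entry k m i)) (List.map suc (upTo k)))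
    * prodL (concatMap (λ j → List.map (λ i →
          ℤ→ℚ (((ℤ.+ entry k m j) ℤ.- (ℤ.+ entry k m i)) ℤ.+ ((ℤ.+ i) ℤ.- (ℤ.+ j))))
          (List.map suc (upTo (j ℕ.∸ 1))))
        (List.map suc (upTo k)))
  summand-entry k m = refl

mutual
  entryOf : ∀ k → Vec ℕ (suc k) → ℕ → ∀ {p} → ℕ → Vec ℕ p → ℕ
  entryOf k m i {p} i′ v = _

  entry-entryOf : ∀ k x y (v : Vec ℕ k) i →
    entry (suc k) (x ∷ y ∷ v) (suc (suc i)) ≡ entryOf (suc k) (x ∷ y ∷ v) (suc (suc i)) i v
  entry-entryOf k x y v i with suc k | x Vec.∷ y Vec.∷ v | suc (suc i)
  ... | _ | _ | _ = refl

entryOf-entryAt : ∀ k m i {p} i′ (v : Vec ℕ p) → entryOf k m i i′ v ≡ entryAt i′ v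
entryOf-entryAt k m i i′       []      = refl
entryOf-entryAt k m i zero     (x ∷ v) = refl
entryOf-entryAt k m i (suc i′) (x ∷ v) = entryOf-entryAt k m i i′ v

entry-entryAt : ∀ k m i → entry k m i ≡ entryAt i m
entry-entryAt k m i = entryOf-entryAt k m i i m

-- The members of `rowLabels 1 v`, since `1 + n ∸ suc i` computes to `n ∸ i`.
rowLabel : ∀ {n} → Vec ℕ n → ℕ → ℕ
rowLabel {n} v i = (n ℕ.∸ i) ℕ.+ entryAt i v

-- The summand k on the right is the index of the last column of a matrix of size k + 1, the T of
-- `det-invCols`.
factorial-index : ∀ k (v : Vec ℕ (suc k)) i → i < suc k →
  (2 ℕ.* suc k ℕ.∸ suc i) ℕ.+ entryAt i v ≡ rowLabel v i ℕ.+ k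
factorial-index k v i i<1+k = begin
  (k ℕ.+ suc (k ℕ.+ 0) ℕ.∸ i) ℕ.+ e    ≡⟨ cong (λ n → (k ℕ.+ suc n ℕ.∸ i) ℕ.+ e) (ℕ.+-identityʳ k) ⟩
  (k ℕ.+ suc k ℕ.∸ i) ℕ.+ e            ≡⟨ cong (ℕ._+ e) (ℕ.+-∸-assoc k (ℕ.<⇒≤ i<1+k)) ⟩
  (k ℕ.+ (suc k ℕ.∸ i)) ℕ.+ e          ≡⟨ rearrange k (suc k ℕ.∸ i) e ⟩
  (suc k ℕ.∸ i) ℕ.+ e ℕ.+ k            ∎
  where
  e = entryAt i v
  rearrange : ∀ a b c → (a ℕ.+ b) ℕ.+ c ≡ b ℕ.+ c ℕ.+ a
  rearrange = solve-∀

ℤ→ℚ-minus : ∀ x y → ℤ→ℚ (x ℤ.- y) ≡ ℤ→ℚ x - ℤ→ℚ y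
ℤ→ℚ-minus x y = trans (ℤ→ℚ-+ x (ℤ.- y)) (cong (λ q → ℤ→ℚ x + q) (ℤ→ℚ-neg y))

ℕ→ℚ-∸ : ∀ {m n} → n ℕ.≤ m → ℕ→ℚ (m ℕ.∸ n) ≡ ℕ→ℚ m - ℕ→ℚ n
ℕ→ℚ-∸ {m} {n} n≤m = begin
  ℕ→ℚ (m ℕ.∸ n)                      ≡⟨ solve 2 (λ a b → a := a :+ b :- b) refl (ℕ→ℚ (m ℕ.∸ n)) (ℕ→ℚ n) ⟩
  ℕ→ℚ (m ℕ.∸ n) + ℕ→ℚ n - ℕ→ℚ n      ≡⟨ cong (_- ℕ→ℚ n) (sym (ℕ→ℚ-+ (m ℕ.∸ n) n)) ⟩
  ℕ→ℚ (m ℕ.∸ n ℕ.+ n) - ℕ→ℚ n        ≡⟨ cong (λ k → ℕ→ℚ k - ℕ→ℚ n) (ℕ.m∸n+n≡m n≤m) ⟩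
  ℕ→ℚ m - ℕ→ℚ n                      ∎

rowLabel-difference : ∀ {n} (v : Vec ℕ n) {i j} → i ℕ.≤ n → j ℕ.≤ n →
  ℤ→ℚ (((ℤ.+ entryAt j v) ℤ.- (ℤ.+ entryAt i v)) ℤ.+ ((ℤ.+ suc i) ℤ.- (ℤ.+ suc j)))
    ≡ ℕ→ℚ (rowLabel v j) - ℕ→ℚ (rowLabel v i)
rowLabel-difference {n} v {i} {j} i≤n j≤n = begin
  ℤ→ℚ (((ℤ.+ y) ℤ.- (ℤ.+ x)) ℤ.+ ((ℤ.+ suc i) ℤ.- (ℤ.+ suc j)))
    ≡⟨ ℤ→ℚ-+ ((ℤ.+ y) ℤ.- (ℤ.+ x)) ((ℤ.+ suc i) ℤ.- (ℤ.+ suc j)) ⟩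
  ℤ→ℚ ((ℤ.+ y) ℤ.- (ℤ.+ x)) + ℤ→ℚ ((ℤ.+ suc i) ℤ.- (ℤ.+ suc j))
    ≡⟨ cong₂ _+_ (ℤ→ℚ-minus (ℤ.+ y) (ℤ.+ x)) (ℤ→ℚ-minus (ℤ.+ suc i) (ℤ.+ suc j)) ⟩
  ℕ→ℚ y - ℕ→ℚ x + (ℕ→ℚ (suc i) - ℕ→ℚ (suc j))
    ≡⟨ cong₂ (λ p q → ℕ→ℚ y - ℕ→ℚ x + (p - q)) (ℕ→ℚ-+ 1 i) (ℕ→ℚ-+ 1 j) ⟩
  ℕ→ℚ y - ℕ→ℚ x + (1ℚ + ℕ→ℚ i - (1ℚ + ℕ→ℚ j))
    ≡⟨ solve 5 (λ y x i j n → y :- x :+ (con 1ℚ :+ i :- (con 1ℚ :+ j)) := n :- j :+ y :- (n :- i :+ x)) refl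
         (ℕ→ℚ y) (ℕ→ℚ x) (ℕ→ℚ i) (ℕ→ℚ j) (ℕ→ℚ n) ⟩
  ℕ→ℚ n - ℕ→ℚ j + ℕ→ℚ y - (ℕ→ℚ n - ℕ→ℚ i + ℕ→ℚ x)
    ≡⟨ cong₂ _-_ (label j≤n y) (label i≤n x) ⟩
  ℕ→ℚ (rowLabel v j) - ℕ→ℚ (rowLabel v i)
    ∎
  where
  x = entryAt i v
  y = entryAt j v
  label : ∀ {i} → i ℕ.≤ n → ∀ z → ℕ→ℚ n - ℕ→ℚ i + ℕ→ℚ z ≡ ℕ→ℚ ((n ℕ.∸ i) ℕ.+ z)
  label {i} i≤n z = trans (cong (_+ ℕ→ℚ z) (sym (ℕ→ℚ-∸ i≤n))) (sym (ℕ→ℚ-+ (n ℕ.∸ i) z))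

labelProduct : ∀ k → Vec ℕ (suc k) → ℚ
labelProduct k v = Π< (suc k) (λ i → inv! (rowLabel v i ℕ.+ k))
  * Π< (suc k) (λ j → Π< j (λ i → ℕ→ℚ (rowLabel v j) - ℕ→ℚ (rowLabel v i)))

-- Separates the head a, whose factors form the coefficient of x^a in e^(-x/2), from the tail, whose
-- factors are those of the Bessel determinant.
summand-∷ : ∀ k a (v : Vec ℕ (suc k)) → summand (suc k) (a ∷ v) ≡
  ℕ→ℚ ((2 ℕ.* suc k) !) * (((- (ℤ.+ 1 / 2)) ^ℚ a) * inv! a * (prodInv! v * labelProduct k v))
summand-∷ k a v = begin
  summand (suc k) m
    ≡⟨ summand-entry (suc k) m ⟩
  C * (inv! a * prodInv! v) * q * prodL (List.map f (List.map suc (upTo (suc k)))) * prodL (concatMap row (List.map suc (upTo (suc k))))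
    ≡⟨ cong₂ (λ x y → C * (inv! a * prodInv! v) * q * x * y) factorials differences ⟩
  C * (inv! a * prodInv! v) * q * X * Y
    ≡⟨ solve 6 (λ c i p q x y → c :* (i :* p) :* q :* x :* y := c :* (q :* i :* (p :* (x :* y)))) refl C (inv! a) (prodInv! v) q X Y ⟩
  C * (q * inv! a * (prodInv! v * (X * Y)))
    ∎
  where
  m = a Vec.∷ v
  C = ℕ→ℚ ((2 ℕ.* suc k) !)
  q = (- (ℤ.+ 1 / 2)) ^ℚ a
  X = Π< (suc k) (λ i → inv! (rowLabel v i ℕ.+ k))
  Y = Π< (suc k) (λ j → Π< j (λ i → ℕ→ℚ (rowLabel v j) - ℕ→ℚ (rowLabel v i)))
  f : ℕ → ℚ
  f i = inv! ((2 ℕ.* suc k ℕ.∸ i) ℕ.+ entry (suc k) m i)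
  d : ℕ → ℕ → ℚ
  d j i = ℤ→ℚ (((ℤ.+ entry (suc k) m j) ℤ.- (ℤ.+ entry (suc k) m i)) ℤ.+ ((ℤ.+ i) ℤ.- (ℤ.+ j)))
  row : ℕ → List ℚ
  row j = List.map (d j) (List.map suc (upTo (j ℕ.∸ 1)))
  factorials : prodL (List.map f (List.map suc (upTo (suc k)))) ≡ X
  factorials = trans (prodL-upTo f (suc k)) (Π<-cong (suc k) (λ i i<1+k → cong inv!
    (trans (cong ((2 ℕ.* suc k ℕ.∸ suc i) ℕ.+_) (entry-entryAt (suc k) m (suc i))) (factorial-index k v i i<1+k))))
  differences : prodL (concatMap row (List.map suc (upTo (suc k)))) ≡ Y
  differences = begin
    prodL (concatMap row (List.map suc (upTo (suc k))))
      ≡⟨ prodL-concatMap row (List.map suc (upTo (suc k))) ⟩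
    prodL (List.map (prodL ∘ row) (List.map suc (upTo (suc k))))
      ≡⟨ prodL-upTo (prodL ∘ row) (suc k) ⟩
    Π< (suc k) (λ j → prodL (row (suc j)))
      ≡⟨ Π<-cong (suc k) (λ j j<1+k → trans (prodL-upTo (d (suc j)) j) (Π<-cong j (λ i i<j →
           trans (cong₂ (λ y x → ℤ→ℚ (((ℤ.+ y) ℤ.- (ℤ.+ x)) ℤ.+ ((ℤ.+ suc i) ℤ.- (ℤ.+ suc j))))
                   (entry-entryAt (suc k) m (suc j)) (entry-entryAt (suc k) m (suc i)))
                 (rowLabel-difference v (ℕ.<⇒≤ (ℕ.<-trans i<j j<1+k)) (ℕ.<⇒≤ j<1+k))))) ⟩
    Y ∎

-- The Bessel determinant

tabulate-invCol : ∀ s n → tabulate {n = n} (λ j → invCol (s ℕ.+ toℕ j)) ≡ invCols s n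
tabulate-invCol s zero    = refl
tabulate-invCol s (suc n) = cong₂ _∷_ (cong invCol (ℕ.+-identityʳ s))
  (trans (tabulate-cong (λ j → cong invCol (ℕ.+-suc s (toℕ j)))) (tabulate-invCol (suc s) n))

det-rowLabels : ∀ k (v : Vec ℕ (suc k)) →
  det (rowLabels 1 v) (tabulate {n = suc k} (invCol ∘ toℕ)) ≡ labelProduct k v
det-rowLabels k v = begin
  det bs (tabulate {n = suc k} (invCol ∘ toℕ))
    ≡⟨ cong (det bs) (tabulate-invCol 0 (suc k)) ⟩
  det bs (invCols 0 (suc k))
    ≡⟨ cong (λ n → det bs (invCols 0 n)) (sym len) ⟩
  det bs (invCols 0 (length bs))
    ≡⟨ det-invCols bs 0 k (trans (ℕ.+-identityʳ (length bs)) len) ⟩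
  prodL (List.map (λ b → inv! (b ℕ.+ k)) bs) * vandermonde bs
    ≡⟨ cong₂ _*_ (prodL-applyDownFrom (λ b → inv! (b ℕ.+ k)) (rowLabel v) (suc k)) (vandermonde-applyDownFrom (rowLabel v) (suc k)) ⟩
  labelProduct k v
    ∎
  where
  bs = rowLabels 1 v
  len : length bs ≡ suc k
  len = length-applyDownFrom (rowLabel v) (suc k)

reducedBessel : ∀ k → Matrix k
reducedBessel k a j l = inv! (suc (toℕ a ℕ.+ toℕ j) ℕ.+ l) * inv! l

-- The Bessel index i + j + 1 is split as a row weight i + 1 and a column weight j; adding both sums
-- at once avoids halves. The offsets c and d make the induction possible, and c = d = 0 gives n².
sum-toℕ : ∀ n c d → ℕΣ.sum {n} (λ a → suc c ℕ.+ toℕ a) ℕ.+ ℕΣ.sum {n} (λ a → d ℕ.+ toℕ a) ≡ n ℕ.* (c ℕ.+ d ℕ.+ n)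
sum-toℕ zero    c d = refl
sum-toℕ (suc n) c d = begin
  (suc c ℕ.+ 0 ℕ.+ ℕΣ.sum {n} (λ a → suc c ℕ.+ suc (toℕ a))) ℕ.+ (d ℕ.+ 0 ℕ.+ ℕΣ.sum {n} (λ a → d ℕ.+ suc (toℕ a)))
    ≡⟨ cong₂ (λ x y → (suc c ℕ.+ 0 ℕ.+ x) ℕ.+ (d ℕ.+ 0 ℕ.+ y))
         (ℕΣ.sum-cong-≗ {n} (λ a → ℕ.+-suc (suc c) (toℕ a))) (ℕΣ.sum-cong-≗ {n} (λ a → ℕ.+-suc d (toℕ a))) ⟩
  (suc c ℕ.+ 0 ℕ.+ x) ℕ.+ (d ℕ.+ 0 ℕ.+ y)
    ≡⟨ rearrange c d x y ⟩
  suc (c ℕ.+ d) ℕ.+ (x ℕ.+ y)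
    ≡⟨ cong (suc (c ℕ.+ d) ℕ.+_) (sum-toℕ n (suc c) (suc d)) ⟩
  suc (c ℕ.+ d) ℕ.+ n ℕ.* (suc c ℕ.+ suc d ℕ.+ n)
    ≡⟨ regroup c d n ⟩
  suc n ℕ.* (c ℕ.+ d ℕ.+ suc n)
    ∎
  where
  x = ℕΣ.sum {n} (λ a → suc (suc c) ℕ.+ toℕ a)
  y = ℕΣ.sum {n} (λ a → suc d ℕ.+ toℕ a)
  rearrange : ∀ c d x y → (suc c ℕ.+ 0 ℕ.+ x) ℕ.+ (d ℕ.+ 0 ℕ.+ y) ≡ suc (c ℕ.+ d) ℕ.+ (x ℕ.+ y)
  rearrange = solve-∀
  regroup : ∀ c d n → suc (c ℕ.+ d) ℕ.+ n ℕ.* (suc c ℕ.+ suc d ℕ.+ n) ≡ suc n ℕ.* (c ℕ.+ d ℕ.+ suc n)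
  regroup = solve-∀

besselDet-shiftUp : ∀ k t → besselDet k t ≡ shiftUp (k ℕ.* k) (dilate (detS k (reducedBessel k))) t
besselDet-shiftUp k t = trans
  (detS-shiftUp-dilate k _ (reducedBessel k) (suc ∘ toℕ) toℕ (λ a j → at2y-besselI (suc (toℕ a ℕ.+ toℕ j))) t)
  (cong (λ w → shiftUp w (dilate (detS k (reducedBessel k))) t) (sum-toℕ k 0 0))

shiftDown-besselDet : ∀ k t → shiftDown (k ℕ.* k) (besselDet k) t ≡ dilate (detS k (reducedBessel k)) t
shiftDown-besselDet k t = begin
  besselDet k (t ℕ.+ k ℕ.* k)                       ≡⟨ cong (besselDet k) (ℕ.+-comm t (k ℕ.* k)) ⟩
  besselDet k (k ℕ.* k ℕ.+ t)                       ≡⟨ besselDet-shiftUp k (k ℕ.* k ℕ.+ t) ⟩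
  shiftUp (k ℕ.* k) (dilate H) (k ℕ.* k ℕ.+ t)      ≡⟨ shiftUp-+ (k ℕ.* k) (dilate H) t ⟩
  dilate H t                                        ∎
  where H = detS k (reducedBessel k)

reducedBessel-coefficient : ∀ k s →
  detS (suc k) (reducedBessel (suc k)) s ≡ ΣC (suc k) s (λ v → prodInv! v * labelProduct k v)
reducedBessel-coefficient k s = trans
  (detS-coefficient (suc k) 1 (invCol ∘ toℕ) (reducedBessel (suc k)) entries s)
  (ΣC-cong (suc k) s (λ v → cong (prodInv! v *_) (det-rowLabels k v)))
  where
  rearrange : ∀ a j l → suc (a ℕ.+ j) ℕ.+ l ≡ suc a ℕ.+ l ℕ.+ j
  rearrange = solve-∀
  entries : ∀ a j l → reducedBessel (suc k) a j l ≡ inv! l * inv! (suc (toℕ a) ℕ.+ l ℕ.+ toℕ j)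
  entries a j l = trans (*-comm (inv! (suc (toℕ a ℕ.+ toℕ j) ℕ.+ l)) (inv! l))
    (cong (λ n → inv! l * inv! n) (rearrange (toℕ a) (toℕ j) l))

theorem3 : (k : ℕ) → bk' (suc k) ≡ rhs (suc k)
theorem3 k = cong (sign K *_) (begin
  C * (expNegHalfX *S shiftDown (K ℕ.* K) (besselDet K)) (2 ℕ.* N)
    ≡⟨ cong (C *_) (*S-cong expNegHalfX≗ (shiftDown-besselDet K) (2 ℕ.* N)) ⟩
  C * (dilate E *S dilate H) (2 ℕ.* N)
    ≡⟨ cong (C *_) (trans (dilate-* E H (2 ℕ.* N)) (dilate-2* (E *S H) N)) ⟩
  C * Σ< (suc N) (λ a → E a * H (N ℕ.∸ a))
    ≡⟨ Σ<-*ˡ (suc N) C (λ a → E a * H (N ℕ.∸ a)) ⟩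
  Σ< (suc N) (λ a → C * (E a * H (N ℕ.∸ a)))
    -- The degree a taken from the exponential becomes m_0, and the entries of v share the remaining
    -- N - a.
    ≡⟨ Σ<-cong′ (suc N) term ⟩
  Σ< (suc N) (λ a → ΣC K (N ℕ.∸ a) (λ v → summand K (a ∷ v)))
    ≡⟨ ΣC-suc K N (summand K) ⟨
  ΣC (suc K) N (summand K)
    ∎)
  where
  K = suc k
  N = 2 ℕ.* K
  C = ℕ→ℚ (N !)
  E H : Series
  E a = ((- (ℤ.+ 1 / 2)) ^ℚ a) * inv! a
  H = detS K (reducedBessel K)
  G : Vec ℕ K → ℚ
  G v = prodInv! v * labelProduct k v
  term : ∀ a → C * (E a * H (N ℕ.∸ a)) ≡ ΣC K (N ℕ.∸ a) (λ v → summand K (a ∷ v))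
  term a = begin
    C * (E a * H (N ℕ.∸ a))
      ≡⟨ cong (λ h → C * (E a * h)) (reducedBessel-coefficient k (N ℕ.∸ a)) ⟩
    C * (E a * ΣC K (N ℕ.∸ a) G)
      ≡⟨ cong (C *_) (ΣC-*ˡ K (N ℕ.∸ a) (E a) G) ⟩
    C * ΣC K (N ℕ.∸ a) (λ v → E a * G v)
      ≡⟨ ΣC-*ˡ K (N ℕ.∸ a) C (λ v → E a * G v) ⟩
    ΣC K (N ℕ.∸ a) (λ v → C * (E a * G v))
      ≡⟨ ΣC-cong K (N ℕ.∸ a) (λ v → sym (summand-∷ k a v)) ⟩
    ΣC K (N ℕ.∸ a) (λ v → summand K (a ∷ v))
      ∎
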